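{- Let $n$ and $r$ be positive integers with $2r \leq n$, and let $G$ be the vertex-disjoint union of $n$ paths each of length $2$ (i.e. each path has $3$ vertices and $2$ edges). Then $G$ is $r$-EKR: if $\mathcal{F}$ is an intersecting family of independent sets of $G$ each of size $r$, then $|\mathcal{F}| \leq \max_{v \in V(G)} |\{A \in \mathcal{I}^{(r)}_G : v \in A\}|$.
   Context: For a graph $G$, $\mathcal{I}^{(r)}_G$ denotes the family of all independent sets of $G$ of size exactly $r$. A family of sets is intersecting if any two of its members have nonempty intersection. For a vertex $v$, the family $\{A \in \mathcal{I}^{(r)}_G : v \in A\}$ is called an $r$-star (with centre $v$). A graph $G$ is called $r$-EKR if no intersecting subfamily of $\mathcal{I}^{(r)}_G$ has more members than the largest $r$-star of $G$. -}

module Defs where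

open import Data.Nat using (ℕ; zero; suc; _*_; _≤_; _⊔_)
open import Data.Nat.Properties using (_≟_)
open import Data.Fin using (Fin; remQuot; quotient; remainder)
import Data.Fin as Fin
import Data.Fin.Properties as FinP
open import Data.Fin.Subset using (Subset; _∈_; _∩_; ∣_∣; Nonempty)
open import Data.Fin.Subset.Properties using (_∈?_)
open import Data.Bool using (true; false)
open import Data.Vec using ([]; _∷_)
open import Data.List using (List; []; _∷_; map; _++_; length; filter; foldr; allFin)
open import Data.List.Membership.Propositional as L using ()
open import Data.List.Relation.Unary.Unique.Propositional using (Unique)
open import Data.Product using (_×_; _,_)
open import Relation.Binary.PropositionalEquality using (_≡_; refl)
open import Relation.Nullary using (¬_; Dec; yes; no; ¬?)
open import Relation.Nullary.Decidable using (_×-dec_; _→-dec_)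

-- A finite simple graph on the vertex set Fin m, given by a decidable
-- adjacency relation (symmetry/irreflexivity are not needed for the
-- notions below; the concrete graph used is symmetric and loopless).
record Graph (m : ℕ) : Set₁ where
  field
    Adj  : Fin m → Fin m → Set
    adj? : (u v : Fin m) → Dec (Adj u v)
open Graph public

Independent : ∀ {m} → Graph m → Subset m → Set
Independent G A = ∀ u v → u ∈ A → v ∈ A → ¬ Adj G u v

independent? : ∀ {m} (G : Graph m) (A : Subset m) → Dec (Independent G A)
independent? G A =
  FinP.all? λ u → FinP.all? λ v →
    (u ∈? A) →-dec ((v ∈? A) →-dec ¬? (adj? G u v))

InI : ∀ {m} → Graph m → ℕ → Subset m → Set
InI G r A = Independent G A × ∣ A ∣ ≡ r

inI? : ∀ {m} (G : Graph m) (r : ℕ) (A : Subset m) → Dec (InI G r A)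
inI? G r A = independent? G A ×-dec (∣ A ∣ ≟ r)

allSubsets : (m : ℕ) → List (Subset m)
allSubsets zero    = [] ∷ []
allSubsets (suc m) = map (true ∷_) (allSubsets m) ++ map (false ∷_) (allSubsets m)

starSize : ∀ {m} → Graph m → ℕ → Fin m → ℕ
starSize {m} G r v =
  length (filter (λ A → inI? G r A ×-dec (v ∈? A)) (allSubsets m))

maxStarSize : ∀ {m} → Graph m → ℕ → ℕ
maxStarSize {m} G r = foldr _⊔_ 0 (map (starSize G r) (allFin m))

IntersectingSubfamily : ∀ {m} → Graph m → ℕ → List (Subset m) → Set
IntersectingSubfamily G r F =
  Unique F
  × (∀ {A} → A L.∈ F → InI G r A)
  × (∀ {A B} → A L.∈ F → B L.∈ F → Nonempty (A ∩ B))

IsEKR : ∀ {m} → Graph m → ℕ → Set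
IsEKR G r = ∀ F → IntersectingSubfamily G r F → length F ≤ maxStarSize G r

data P₃Adj : Fin 3 → Fin 3 → Set where
  e01 : P₃Adj Fin.zero (Fin.suc Fin.zero)
  e10 : P₃Adj (Fin.suc Fin.zero) Fin.zero
  e12 : P₃Adj (Fin.suc Fin.zero) (Fin.suc (Fin.suc Fin.zero))
  e21 : P₃Adj (Fin.suc (Fin.suc Fin.zero)) (Fin.suc Fin.zero)

p₃Adj? : (a b : Fin 3) → Dec (P₃Adj a b)
p₃Adj? Fin.zero Fin.zero = no λ ()
p₃Adj? Fin.zero (Fin.suc Fin.zero) = yes e01
p₃Adj? Fin.zero (Fin.suc (Fin.suc Fin.zero)) = no λ ()
p₃Adj? (Fin.suc Fin.zero) Fin.zero = yes e10
p₃Adj? (Fin.suc Fin.zero) (Fin.suc Fin.zero) = no λ ()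
p₃Adj? (Fin.suc Fin.zero) (Fin.suc (Fin.suc Fin.zero)) = yes e12
p₃Adj? (Fin.suc (Fin.suc Fin.zero)) Fin.zero = no λ ()
p₃Adj? (Fin.suc (Fin.suc Fin.zero)) (Fin.suc Fin.zero) = yes e21
p₃Adj? (Fin.suc (Fin.suc Fin.zero)) (Fin.suc (Fin.suc Fin.zero)) = no λ ()

copyOf : (n : ℕ) → Fin (n * 3) → Fin n
copyOf n u = quotient {n} 3 u

posOf : (n : ℕ) → Fin (n * 3) → Fin 3
posOf n u = remainder {n} 3 u

pathUnion : (n : ℕ) → Graph (n * 3)
pathUnion n = record
  { Adj  = λ u v → copyOf n u ≡ copyOf n v × P₃Adj (posOf n u) (posOf n v)
  ; adj? = λ u v → (copyOf n u FinP.≟ copyOf n v) ×-dec p₃Adj? (posOf n u) (posOf n v)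
  }

{-# OPTIONS --safe #-}

-- Record an independent set as a word of n letters, its traces on the paths.
-- Shifting centres to left leaves turns the family into one of the same size in
-- which any two members share a leaf.  Now average over the permutations and
-- reflections of the paths, as in Katona's cycle method: for a word w with t
-- leaves, the words obtained by reading every other letter of
-- right^a both^2p left^a z z ... cyclically from each of the 2n positions
-- (a singles, p doubles, t = a + 2p, every leafless letter z repeated) are all
-- rearrangements of w, and two of them at circular distance at least t share no
-- leaf.  As t ≤ r ≤ n, at most t of these 2n words lie in the family, so
-- 2n |F| is at most the sum of the leaf numbers of all independent r-sets, which
-- is the sum of the sizes of the 2n stars centred at leaves.
module Submission where

open import Defs
open import Data.Bool using (Bool; true; false; _∧_; _∨_)
open import Data.Bool.Properties using (∨-zeroʳ; ∨-comm) renaming (_≟_ to _≟ᵇ_)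
open import Data.Empty using (⊥; ⊥-elim)
open import Data.Fin using (Fin; zero; suc)
import Data.Fin.Properties as Fin
open import Data.Fin.Subset using (Subset; ∣_∣) renaming (_∈_ to _∈ˢ_)
open import Data.Fin.Subset.Properties using (_∈?_; x∈p∩q⁻)
open import Data.List
  using (List; []; _∷_; _++_; map; length; concatMap; applyUpTo; upTo; replicate; filter; foldr; allFin)
import Data.List.Properties as List
open import Data.List.Properties
  using (map-applyUpTo; applyUpTo-∷ʳ; length-map; length-++; length-applyUpTo; length-replicate;
         length-upTo; filter-++; ++-identityʳ)
open import Data.List.Membership.Propositional using (_∈_)
open import Data.List.Membership.Propositional.Properties using (∈-map⁻; ∈-allFin)
open import Data.List.Relation.Binary.Pointwise using ([]; _∷_)
import Data.List.Relation.Binary.Permutation.Setoid as Permutation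
import Data.List.Relation.Binary.Permutation.Setoid.Properties as PermutationProperties
open import Data.List.Relation.Unary.All as All using (All; []; _∷_)
open import Data.List.Relation.Unary.All.Properties
  using (++⁺; replicate⁺; applyUpTo⁺₁; applyUpTo⁺₂; All¬⇒¬Any)
open import Data.List.Relation.Unary.AllPairs using ([]; _∷_)
open import Data.List.Relation.Unary.Any using (here; there)
open import Data.List.Relation.Unary.Unique.Propositional using (Unique)
open import Data.Nat
open import Data.Nat.DivMod using (_%_; m%n<n; m<n⇒m%n≡m; [m+n]%n≡m%n; %-distribˡ-+; m%n%n≡m%n)
open import Data.Nat.Properties
open import Data.Nat.Tactic.RingSolver using (solve-∀)
open import Data.Product using (∃-syntax; ∃₂; _×_; _,_; proj₁; proj₂)
import Data.Product.Properties as Product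
open import Data.Sum using (_⊎_; inj₁; inj₂)
open import Data.Vec using ([]; _∷_; lookup) renaming (here to hereᵛ; there to thereᵛ)
open import Data.Vec.Properties using (lookup⇒[]=; []=⇒lookup)
open import Function using (_∘_; id; _$_)
import Relation.Binary.Construct.On as On
open import Relation.Binary.PropositionalEquality
open import Relation.Nullary using (Dec; yes; no; does; contradiction)
open import Relation.Nullary.Decidable using (map′; _×-dec_; dec-true; dec-false)
open import Relation.Unary using (Decidable)

-- The centres have to go first because `mid` fits on no arc: repeated in the tail of the circle, it
-- could be common to two rotations at distance t or more. The circle has 2n positions because a
-- fixed leaf lies, by symmetry, in the fraction t / 2n of the orbit of a word with t leaves. A star
-- at a leaf attains this fraction, so the cycle has to yield exactly this bound. A word has only n
-- letters, hence every other position is read. At each place, the rotations starting at i and j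
-- show letters at the same distance j - i on the circle. It therefore suffices that letters at
-- circular distance at least t share no leaf, and this holds once the left leaves and the right
-- leaves each fill a single arc of t positions. Either reading must contain p doubles, so the
-- circle carries 2p of them. The two arcs overlap in these doubles, which puts the singles at the
-- outer ends, as `right` before and `left` after. The number t varies among words of one size, so
-- every word gets its own circle, and the bounds t / 2n are summed over all words instead of being
-- replaced by a common one.

private variable
  A B : Set

-- Finite sums over lists.

𝟙 : Bool → ℕ
𝟙 true  = 1
𝟙 false = 0

∑ : List A → (A → ℕ) → ℕ
∑ []       f = 0
∑ (x ∷ xs) f = f x + ∑ xs f

∑-cong : ∀ (xs : List A) {f g : A → ℕ} → (∀ x → f x ≡ g x) → ∑ xs f ≡ ∑ xs g
∑-cong []       f≗g = refl
∑-cong (x ∷ xs) f≗g = cong₂ _+_ (f≗g x) (∑-cong xs f≗g)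

∑-mono : ∀ {xs : List A} {f g : A → ℕ} → All (λ x → f x ≤ g x) xs → ∑ xs f ≤ ∑ xs g
∑-mono []       = z≤n
∑-mono (p ∷ ps) = +-mono-≤ p (∑-mono ps)

∑-congᴬ : ∀ {xs : List A} {f g : A → ℕ} → All (λ x → f x ≡ g x) xs → ∑ xs f ≡ ∑ xs g
∑-congᴬ []       = refl
∑-congᴬ (p ∷ ps) = cong₂ _+_ p (∑-congᴬ ps)

∑-bound : ∀ {xs : List A} {f : A → ℕ} {b} → All (λ x → f x ≤ b) xs → ∑ xs f ≤ length xs * b
∑-bound []       = z≤n
∑-bound (p ∷ ps) = +-mono-≤ p (∑-bound ps)

∑-const : ∀ (xs : List A) b → ∑ xs (λ _ → b) ≡ length xs * b
∑-const []       b = refl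
∑-const (x ∷ xs) b = cong (b +_) (∑-const xs b)

∑-0 : ∀ (xs : List A) → ∑ xs (λ _ → 0) ≡ 0
∑-0 []       = refl
∑-0 (x ∷ xs) = ∑-0 xs

+-interchange : ∀ a b c d → (a + b) + (c + d) ≡ (a + c) + (b + d)
+-interchange = solve-∀

∑-+ : ∀ (xs : List A) (f g : A → ℕ) → ∑ xs (λ x → f x + g x) ≡ ∑ xs f + ∑ xs g
∑-+ []       f g = refl
∑-+ (x ∷ xs) f g = trans (cong (f x + g x +_) (∑-+ xs f g)) (+-interchange (f x) (g x) _ _)

∑-* : ∀ k (xs : List A) (f : A → ℕ) → ∑ xs (λ x → k * f x) ≡ k * ∑ xs f
∑-* k []       f = sym (*-zeroʳ k)
∑-* k (x ∷ xs) f = trans (cong (k * f x +_) (∑-* k xs f)) (sym (*-distribˡ-+ k (f x) _))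

∑-swap : ∀ (xs : List A) (ys : List B) (f : A → B → ℕ) →
         ∑ xs (λ x → ∑ ys (f x)) ≡ ∑ ys (λ y → ∑ xs (λ x → f x y))
∑-swap []       ys f = sym (∑-0 ys)
∑-swap (x ∷ xs) ys f = trans (cong (∑ ys (f x) +_) (∑-swap xs ys f)) (sym (∑-+ ys (f x) _))

∑-++ : ∀ (xs ys : List A) (f : A → ℕ) → ∑ (xs ++ ys) f ≡ ∑ xs f + ∑ ys f
∑-++ []       ys f = refl
∑-++ (x ∷ xs) ys f = trans (cong (f x +_) (∑-++ xs ys f)) (sym (+-assoc (f x) _ _))

∑-map : ∀ (h : A → B) (xs : List A) (f : B → ℕ) → ∑ (map h xs) f ≡ ∑ xs (f ∘ h)
∑-map h []       f = refl
∑-map h (x ∷ xs) f = cong (f (h x) +_) (∑-map h xs f)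

∑-concatMap : ∀ (h : A → List B) (xs : List A) (f : B → ℕ) →
              ∑ (concatMap h xs) f ≡ ∑ xs (λ x → ∑ (h x) f)
∑-concatMap h []       f = refl
∑-concatMap h (x ∷ xs) f =
  trans (∑-++ (h x) (concatMap h xs) f) (cong (∑ (h x) f +_) (∑-concatMap h xs f))

∑-length : ∀ (xs : List A) → ∑ xs (λ _ → 1) ≡ length xs
∑-length xs = trans (∑-const xs 1) (*-identityʳ (length xs))

-- Insertions, and orbits under permutations with letterwise maps.

insertions : A → List A → List (List A)
insertions a []      = (a ∷ []) ∷ []
insertions a (b ∷ v) = (a ∷ b ∷ v) ∷ map (b ∷_) (insertions a v)

∑-insertions-∷ : ∀ (a b : A) v f →
  ∑ (insertions a (b ∷ v)) f ≡ f (a ∷ b ∷ v) + ∑ (insertions a v) (f ∘ (b ∷_))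
∑-insertions-∷ a b v f = cong (f (a ∷ b ∷ v) +_) (∑-map (b ∷_) (insertions a v) f)

∑-insertions-map : ∀ (h : A → B) a v f →
  ∑ (insertions (h a) (map h v)) f ≡ ∑ (insertions a v) (f ∘ map h)
∑-insertions-map h a []      f = refl
∑-insertions-map h a (b ∷ v) f = begin
  ∑ (insertions (h a) (h b ∷ map h v)) f
    ≡⟨ ∑-insertions-∷ (h a) (h b) (map h v) f ⟩
  f (h a ∷ h b ∷ map h v) + ∑ (insertions (h a) (map h v)) (f ∘ (h b ∷_))
    ≡⟨ cong (f (h a ∷ h b ∷ map h v) +_) (∑-insertions-map h a v (f ∘ (h b ∷_))) ⟩
  f (h a ∷ h b ∷ map h v) + ∑ (insertions a v) (f ∘ map h ∘ (b ∷_))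
    ≡⟨ ∑-insertions-∷ a b v (f ∘ map h) ⟨
  ∑ (insertions a (b ∷ v)) (f ∘ map h) ∎
  where open ≡-Reasoning

-- Either side runs once through the ways to place both letters: a slot of `v` for each, and an
-- order when the slots coincide.
∑-insertions-comm : ∀ (a b : A) v f →
  ∑ (insertions b v) (λ u → ∑ (insertions a u) f) ≡
  ∑ (insertions a v) (λ u → ∑ (insertions b u) f)
∑-insertions-comm a b [] f = lemma (f (a ∷ b ∷ [])) (f (b ∷ a ∷ []))
  where
  lemma : ∀ p q → p + (q + 0) + 0 ≡ q + (p + 0) + 0
  lemma = solve-∀
∑-insertions-comm a b (c ∷ v) f = begin
  ∑ (insertions b (c ∷ v)) (λ u → ∑ (insertions a u) f)
    ≡⟨ unfold a b ⟩
  (f (a ∷ b ∷ c ∷ v) + (f (b ∷ a ∷ c ∷ v) + Σ₁ a b)) + (Σ₁ b a + Σ₂ a b)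
    ≡⟨ cong (λ z → (f (a ∷ b ∷ c ∷ v) + (f (b ∷ a ∷ c ∷ v) + Σ₁ a b)) + (Σ₁ b a + z))
            (∑-insertions-comm a b v (f ∘ (c ∷_))) ⟩
  (f (a ∷ b ∷ c ∷ v) + (f (b ∷ a ∷ c ∷ v) + Σ₁ a b)) + (Σ₁ b a + Σ₂ b a)
    ≡⟨ lemma (f (a ∷ b ∷ c ∷ v)) (f (b ∷ a ∷ c ∷ v)) (Σ₁ a b) (Σ₁ b a) (Σ₂ b a) ⟩
  (f (b ∷ a ∷ c ∷ v) + (f (a ∷ b ∷ c ∷ v) + Σ₁ b a)) + (Σ₁ a b + Σ₂ b a)
    ≡⟨ unfold b a ⟨
  ∑ (insertions a (c ∷ v)) (λ u → ∑ (insertions b u) f) ∎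
  where
  open ≡-Reasoning
  Σ₁ Σ₂ : _ → _ → ℕ
  Σ₁ x y = ∑ (insertions x v) (λ u → f (y ∷ c ∷ u))
  Σ₂ x y = ∑ (insertions y v) (λ u → ∑ (insertions x u) (f ∘ (c ∷_)))
  unfold : ∀ x y → ∑ (insertions y (c ∷ v)) (λ u → ∑ (insertions x u) f) ≡
    (f (x ∷ y ∷ c ∷ v) + (f (y ∷ x ∷ c ∷ v) + Σ₁ x y)) + (Σ₁ y x + Σ₂ x y)
  unfold x y = begin
    ∑ (insertions y (c ∷ v)) (λ u → ∑ (insertions x u) f)
      ≡⟨ ∑-insertions-∷ y c v _ ⟩
    ∑ (insertions x (y ∷ c ∷ v)) f + ∑ (insertions y v) (λ u → ∑ (insertions x (c ∷ u)) f)
      ≡⟨ cong₂ _+_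
           (trans (∑-insertions-∷ x y (c ∷ v) f)
                  (cong (f (x ∷ y ∷ c ∷ v) +_) (∑-insertions-∷ x c v (f ∘ (y ∷_)))))
           (trans (∑-cong (insertions y v) (λ u → ∑-insertions-∷ x c u f))
                  (∑-+ (insertions y v) _ _)) ⟩
    (f (x ∷ y ∷ c ∷ v) + (f (y ∷ x ∷ c ∷ v) + Σ₁ x y)) + (Σ₁ y x + Σ₂ x y) ∎
  lemma : ∀ p q r s t → (p + (q + r)) + (s + t) ≡ (q + (p + s)) + (r + t)
  lemma = solve-∀

All-concatMap : ∀ {P : B → Set} {Q : A → Set} (h : A → List B) {xs} →
  (∀ {x} → Q x → All P (h x)) → All Q xs → All P (concatMap h xs)
All-concatMap h imp []       = []
All-concatMap h imp (q ∷ qs) = ++⁺ (imp q) (All-concatMap h imp qs)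

All-map : ∀ {P : B → Set} {Q : A → Set} (h : A → B) {xs} →
  (∀ {x} → Q x → P (h x)) → All Q xs → All P (map h xs)
All-map h imp []       = []
All-map h imp (q ∷ qs) = imp q ∷ All-map h imp qs

insertions-All : ∀ {P : A → Set} {a v} → P a → All P v → All (All P) (insertions a v)
insertions-All pa []        = (pa ∷ []) ∷ []
insertions-All pa (pb ∷ pv) = (pa ∷ pb ∷ pv) ∷ All-map _ (pb ∷_) (insertions-All pa pv)

insertions-∑ : ∀ (g : A → ℕ) a v → All (λ u → ∑ u g ≡ g a + ∑ v g) (insertions a v)
insertions-∑ g a []      = refl ∷ []
insertions-∑ g a (b ∷ v) = refl ∷ All-map (b ∷_)
  (λ eq → trans (cong (g b +_) eq) (lemma (g b) (g a) (∑ v g))) (insertions-∑ g a v)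
  where
  lemma : ∀ x y z → x + (y + z) ≡ y + (x + z)
  lemma = solve-∀

-- This is 2^n n!, the number of signed permutations of n places.
orbitSize : ℕ → ℕ
orbitSize zero    = 1
orbitSize (suc n) = orbitSize n * (suc n + suc n)

orbitSize≢0 : ∀ n → NonZero (orbitSize n)
orbitSize≢0 zero    = _
orbitSize≢0 (suc n) = m*n≢0 (orbitSize n) (suc n + suc n) {{orbitSize≢0 n}}

length-insertions : ∀ (a : A) v → length (insertions a v) ≡ suc (length v)
length-insertions a []      = refl
length-insertions a (b ∷ v) =
  cong suc (trans (length-map (b ∷_) (insertions a v)) (length-insertions a v))

opaque
  -- The orbit, with multiplicities, of a word under permutations of its letters
  -- combined with applications of φ to single letters.
  orbit : (A → A) → List A → List (List A)
  orbit φ []      = [] ∷ []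
  orbit φ (a ∷ w) = concatMap (λ v → insertions a v ++ insertions (φ a) v) (orbit φ w)

  ∑-orbit-[] : ∀ (φ : A → A) f → ∑ (orbit φ []) f ≡ f [] + 0
  ∑-orbit-[] φ f = refl

  ∑-orbit-∷ : ∀ (φ : A → A) a w f →
    ∑ (orbit φ (a ∷ w)) f ≡
    ∑ (orbit φ w) (λ v → ∑ (insertions a v) f + ∑ (insertions (φ a) v) f)
  ∑-orbit-∷ φ a w f = trans (∑-concatMap _ (orbit φ w) f)
    (∑-cong (orbit φ w) (λ v → ∑-++ (insertions a v) (insertions (φ a) v) f))

  -- With `h` the evaluation of a column at i, a single orbit of columns describes the orbits of all
  -- rotations at once.
  ∑-orbit-map : ∀ {φ : A → A} {ψ : B → B} (h : A → B) → (∀ a → ψ (h a) ≡ h (φ a)) →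
    ∀ w f → ∑ (orbit ψ (map h w)) f ≡ ∑ (orbit φ w) (f ∘ map h)
  ∑-orbit-map h comm []      f = refl
  ∑-orbit-map {φ = φ} {ψ} h comm (a ∷ w) f = begin
    ∑ (orbit ψ (h a ∷ map h w)) f
      ≡⟨ ∑-orbit-∷ ψ (h a) (map h w) f ⟩
    ∑ (orbit ψ (map h w)) (λ v → ∑ (insertions (h a) v) f + ∑ (insertions (ψ (h a)) v) f)
      ≡⟨ ∑-orbit-map h comm w _ ⟩
    ∑ (orbit φ w) (λ v → ∑ (insertions (h a) (map h v)) f + ∑ (insertions (ψ (h a)) (map h v)) f)
      ≡⟨ ∑-cong (orbit φ w) (λ v → cong₂ _+_ (∑-insertions-map h a v f)
           (trans (cong (λ b → ∑ (insertions b (map h v)) f) (comm a))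
                  (∑-insertions-map h (φ a) v f))) ⟩
    ∑ (orbit φ w) (λ v → ∑ (insertions a v) (f ∘ map h) + ∑ (insertions (φ a) v) (f ∘ map h))
      ≡⟨ ∑-orbit-∷ φ a w (f ∘ map h) ⟨
    ∑ (orbit φ (a ∷ w)) (f ∘ map h) ∎
    where open ≡-Reasoning

  orbit-All : ∀ {P : A → Set} {φ : A → A} → (∀ {a} → P a → P (φ a)) →
    ∀ {w} → All P w → All (All P) (orbit φ w)
  orbit-All closed []        = [] ∷ []
  orbit-All closed (pa ∷ pw) = All-concatMap _
    (λ pv → ++⁺ (insertions-All pa pv) (insertions-All (closed pa) pv))
    (orbit-All closed pw)

  orbit-∑ : ∀ {φ : A → A} (g : A → ℕ) → (∀ a → g (φ a) ≡ g a) →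
    ∀ w → All (λ u → ∑ u g ≡ ∑ w g) (orbit φ w)
  orbit-∑ g inv []      = refl ∷ []
  orbit-∑ {φ = φ} g inv (a ∷ w) = All-concatMap _
    (λ {v} eq → ++⁺
      (All.map (λ eq′ → trans eq′ (cong (g a +_) eq)) (insertions-∑ g a v))
      (All.map (λ eq′ → trans eq′ (cong₂ _+_ (inv a) eq)) (insertions-∑ g (φ a) v)))
    (orbit-∑ g inv w)

  length-orbit : ∀ (φ : A → A) w → length (orbit φ w) ≡ orbitSize (length w)
  length-orbit φ []      = refl
  length-orbit {A = A} φ (a ∷ w) = begin
    length (orbit φ (a ∷ w))
      ≡⟨ ∑-length (orbit φ (a ∷ w)) ⟨
    ∑ (orbit φ (a ∷ w)) (λ _ → 1)
      ≡⟨ ∑-orbit-∷ φ a w _ ⟩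
    ∑ (orbit φ w) (λ v → ∑ (insertions a v) (λ _ → 1) + ∑ (insertions (φ a) v) (λ _ → 1))
      ≡⟨ ∑-congᴬ (All.map (λ {v} eq → cong₂ _+_ (count a v eq) (count (φ a) v eq))
           (All.map (λ {v} eq → trans (sym (∑-length v)) (trans eq (∑-length w)))
             (orbit-∑ (λ _ → 1) (λ _ → refl) w))) ⟩
    ∑ (orbit φ w) (λ _ → suc (length w) + suc (length w))
      ≡⟨ ∑-const (orbit φ w) _ ⟩
    length (orbit φ w) * (suc (length w) + suc (length w))
      ≡⟨ cong (_* (suc (length w) + suc (length w))) (length-orbit φ w) ⟩
    orbitSize (length (a ∷ w)) ∎
    where
    open ≡-Reasoning
    count : ∀ (b : A) v → length v ≡ length w → ∑ (insertions b v) (λ _ → 1) ≡ suc (length w)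
    count b v eq = trans (∑-length (insertions b v)) (trans (length-insertions b v) (cong suc eq))

-- Traces, words, and words up to permutations and flips.

-- The possible traces of an independent set on one path; mid is the centre.
data Trace : Set where
  none mid left right both : Trace

Word : Set
Word = List Trace

flip : Trace → Trace
flip none  = none
flip mid   = mid
flip left  = right
flip right = left
flip both  = both

weight : Trace → ℕ
weight none  = 0
weight mid   = 1
weight left  = 1
weight right = 1
weight both  = 2

leafCount : Trace → ℕ
leafCount none  = 0
leafCount mid   = 0
leafCount left  = 1
leafCount right = 1
leafCount both  = 2

size leaves : Word → ℕ
size w   = ∑ w weight
leaves w = ∑ w leafCount

hasLeft hasRight hasMid : Trace → Bool
hasLeft left  = true
hasLeft both  = true
hasLeft _     = false
hasRight right = true
hasRight both  = true
hasRight _     = false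
hasMid mid = true
hasMid _   = false

leafHit hit : Trace → Trace → Bool
leafHit s s′ = (hasLeft s ∧ hasLeft s′) ∨ (hasRight s ∧ hasRight s′)
hit s s′     = leafHit s s′ ∨ (hasMid s ∧ hasMid s′)

meet : (Trace → Trace → Bool) → Word → Word → Bool
meet h (s ∷ v) (s′ ∷ w) = h s s′ ∨ meet h v w
meet h _       _        = false

-- A representative of each flip class: pulling equality back along it makes the setoid permutations
-- absorb flips.
unflip : Trace → Trace
unflip right = left
unflip s     = s

-- Words up to permutations and flips of letters.
open Permutation (On.setoid (setoid Trace) unflip)
  using (_↭_; refl; prep; swap; ↭-refl; ↭-sym; ↭-trans; ↭-prep; ↭-reflexive)
  renaming (trans to compose)
open PermutationProperties (On.setoid (setoid Trace) unflip) using (↭-shift; ++⁺ˡ)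

flip-involutive : ∀ s → flip (flip s) ≡ s
flip-involutive none  = refl
flip-involutive mid   = refl
flip-involutive left  = refl
flip-involutive right = refl
flip-involutive both  = refl

unflip-kernel : ∀ s s′ → unflip s ≡ unflip s′ → s ≡ s′ ⊎ s ≡ flip s′
unflip-kernel none  none  refl = inj₁ refl
unflip-kernel none  mid   ()
unflip-kernel none  left  ()
unflip-kernel none  right ()
unflip-kernel none  both  ()
unflip-kernel mid   mid   refl = inj₁ refl
unflip-kernel mid   none  ()
unflip-kernel mid   left  ()
unflip-kernel mid   right ()
unflip-kernel mid   both  ()
unflip-kernel left  left  refl = inj₁ refl
unflip-kernel left  right refl = inj₂ refl
unflip-kernel right left  refl = inj₂ refl
unflip-kernel right right refl = inj₁ refl
unflip-kernel right both  ()
unflip-kernel both  both  refl = inj₁ refl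
unflip-kernel both  right ()

-- The operator by which one letter acts on `f`. An orbit sum applies one such operator per letter,
-- so its invariance under rearrangement comes down to these operators commuting and not seeing
-- flips.
spread : Trace → (Word → ℕ) → Word → ℕ
spread s f v = ∑ (insertions s v) f + ∑ (insertions (flip s) v) f

spread-cong : ∀ {s s′} → unflip s ≡ unflip s′ → ∀ f v → spread s f v ≡ spread s′ f v
spread-cong {s} {s′} eq f v with unflip-kernel s s′ eq
... | inj₁ refl = refl
... | inj₂ refl = trans
  (cong (λ t → ∑ (insertions (flip s′) v) f + ∑ (insertions t v) f) (flip-involutive s′))
  (+-comm (∑ (insertions (flip s′) v) f) _)

spread-comm : ∀ s s′ f v → spread s (spread s′ f) v ≡ spread s′ (spread s f) v
spread-comm s s′ f v = begin
  spread s (spread s′ f) v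
    ≡⟨ expand s s′ ⟩
  (⟨ s , s′ ⟩ + ⟨ s , flip s′ ⟩) + (⟨ flip s , s′ ⟩ + ⟨ flip s , flip s′ ⟩)
    ≡⟨ cong₂ _+_ (cong₂ _+_ (comm s s′) (comm s (flip s′)))
                 (cong₂ _+_ (comm (flip s) s′) (comm (flip s) (flip s′))) ⟩
  (⟨ s′ , s ⟩ + ⟨ flip s′ , s ⟩) + (⟨ s′ , flip s ⟩ + ⟨ flip s′ , flip s ⟩)
    ≡⟨ +-interchange ⟨ s′ , s ⟩ ⟨ flip s′ , s ⟩ _ _ ⟩
  (⟨ s′ , s ⟩ + ⟨ s′ , flip s ⟩) + (⟨ flip s′ , s ⟩ + ⟨ flip s′ , flip s ⟩)
    ≡⟨ expand s′ s ⟨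
  spread s′ (spread s f) v ∎
  where
  open ≡-Reasoning
  ⟨_,_⟩ : Trace → Trace → ℕ
  ⟨ a , b ⟩ = ∑ (insertions a v) (λ u → ∑ (insertions b u) f)
  comm : ∀ a b → ⟨ a , b ⟩ ≡ ⟨ b , a ⟩
  comm a b = ∑-insertions-comm b a v f
  expand : ∀ a b → spread a (spread b f) v ≡
    (⟨ a , b ⟩ + ⟨ a , flip b ⟩) + (⟨ flip a , b ⟩ + ⟨ flip a , flip b ⟩)
  expand a b = cong₂ _+_ (∑-+ (insertions a v) _ _) (∑-+ (insertions (flip a) v) _ _)

∑-orbit-prep : ∀ {s s′ v w} → unflip s ≡ unflip s′ →
  (∀ f → ∑ (orbit flip v) f ≡ ∑ (orbit flip w) f) →
  ∀ f → ∑ (orbit flip (s ∷ v)) f ≡ ∑ (orbit flip (s′ ∷ w)) f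
∑-orbit-prep {s} {s′} {v} {w} s≈s′ v≈w f = begin
  ∑ (orbit flip (s ∷ v)) f     ≡⟨ ∑-orbit-∷ flip s v f ⟩
  ∑ (orbit flip v) (spread s f)  ≡⟨ ∑-cong (orbit flip v) (spread-cong s≈s′ f) ⟩
  ∑ (orbit flip v) (spread s′ f) ≡⟨ v≈w (spread s′ f) ⟩
  ∑ (orbit flip w) (spread s′ f) ≡⟨ ∑-orbit-∷ flip s′ w f ⟨
  ∑ (orbit flip (s′ ∷ w)) f    ∎
  where open ≡-Reasoning

∑-orbit-swap : ∀ s s′ w f → ∑ (orbit flip (s ∷ s′ ∷ w)) f ≡ ∑ (orbit flip (s′ ∷ s ∷ w)) f
∑-orbit-swap s s′ w f = begin
  ∑ (orbit flip (s ∷ s′ ∷ w)) f              ≡⟨ unfold s s′ ⟩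
  ∑ (orbit flip w) (spread s′ (spread s f))  ≡⟨ ∑-cong (orbit flip w) (spread-comm s′ s f) ⟩
  ∑ (orbit flip w) (spread s (spread s′ f))  ≡⟨ unfold s′ s ⟨
  ∑ (orbit flip (s′ ∷ s ∷ w)) f              ∎
  where
  open ≡-Reasoning
  unfold : ∀ a b → ∑ (orbit flip (a ∷ b ∷ w)) f ≡ ∑ (orbit flip w) (spread b (spread a f))
  unfold a b = trans (∑-orbit-∷ flip a (b ∷ w) f) (∑-orbit-∷ flip b w (spread a f))

∑-orbit-↭ : ∀ {v w} → v ↭ w → ∀ f → ∑ (orbit flip v) f ≡ ∑ (orbit flip w) f
∑-orbit-↭ (refl [])           f = refl
∑-orbit-↭ (refl (s≈s′ ∷ v≈w)) f = ∑-orbit-prep s≈s′ (∑-orbit-↭ (refl v≈w)) f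
∑-orbit-↭ (prep s≈s′ v↭w)     f = ∑-orbit-prep s≈s′ (∑-orbit-↭ v↭w) f
∑-orbit-↭ (swap {x = a} {y = b} a≈a′ b≈b′ v↭w) f = trans
  (∑-orbit-swap a b _ f)
  (∑-orbit-prep b≈b′ (∑-orbit-prep a≈a′ (∑-orbit-↭ v↭w)) f)
∑-orbit-↭ (compose u↭v v↭w)   f = trans (∑-orbit-↭ u↭v f) (∑-orbit-↭ v↭w f)

-- All words of length n, and the sum of their orbits.

opaque
  traces : List Trace
  traces = both ∷ left ∷ mid ∷ right ∷ none ∷ []

  words : ℕ → List Word
  words zero    = [] ∷ []
  words (suc n) = concatMap (λ s → map (s ∷_) (words n)) traces

  words-length : ∀ n → All (λ w → length w ≡ n) (words n)
  words-length zero    = refl ∷ []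
  words-length (suc n) = All-concatMap {Q = λ _ → ℕ} _
    (λ {s} _ → All-map (s ∷_) (cong suc) (words-length n)) (0 ∷ 0 ∷ 0 ∷ 0 ∷ 0 ∷ [])

  ∑-traces : ∀ g → ∑ traces g ≡ g both + (g left + (g mid + (g right + (g none + 0))))
  ∑-traces g = refl

  ∑-words-zero : ∀ f → ∑ (words 0) f ≡ f [] + 0
  ∑-words-zero f = refl

  ∑-words-suc : ∀ n f → ∑ (words (suc n)) f ≡ ∑ traces (λ s → ∑ (words n) (f ∘ (s ∷_)))
  ∑-words-suc n f = trans (∑-concatMap (λ s → map (s ∷_) (words n)) traces f)
    (∑-cong traces (λ s → ∑-map (s ∷_) (words n) f))

∑-traces-flip : ∀ (g : Trace → ℕ) → ∑ traces (g ∘ flip) ≡ ∑ traces g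
∑-traces-flip g = trans (∑-traces (g ∘ flip))
  (trans (lemma (g both) (g left) (g mid) (g right) (g none)) (sym (∑-traces g)))
  where
  lemma : ∀ a b c d e → a + (d + (c + (b + (e + 0)))) ≡ a + (b + (c + (d + (e + 0))))
  lemma = solve-∀

-- A word of length n + 1 arises n + 1 times, once for each of its positions taken as the place of
-- the inserted letter.
∑-words-insertions : ∀ n f →
  ∑ traces (λ s → ∑ (words n) (λ v → ∑ (insertions s v) f)) ≡ suc n * ∑ (words (suc n)) f
∑-words-insertions zero    f = begin
  ∑ traces (λ s → ∑ (words 0) (λ v → ∑ (insertions s v) f))
    ≡⟨ ∑-cong traces (λ s → trans (∑-words-zero (λ v → ∑ (insertions s v) f))
         (trans (+-identityʳ (f (s ∷ []) + 0)) (sym (∑-words-zero (f ∘ (s ∷_)))))) ⟩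
  ∑ traces (λ s → ∑ (words 0) (f ∘ (s ∷_)))
    ≡⟨ ∑-words-suc 0 f ⟨
  ∑ (words 1) f
    ≡⟨ *-identityˡ (∑ (words 1) f) ⟨
  1 * ∑ (words 1) f ∎
  where open ≡-Reasoning
∑-words-insertions (suc n) f = begin
  ∑ traces (λ s → ∑ (words (suc n)) (λ v → ∑ (insertions s v) f))
    ≡⟨ ∑-cong traces (λ s → trans (∑-words-suc n _) (∑-cong traces (λ s′ →
         trans (∑-cong (words n) (λ v → ∑-insertions-∷ s s′ v f)) (∑-+ (words n) _ _)))) ⟩
  ∑ traces (λ s → ∑ traces (λ s′ → ∑ (words n) (λ v → f (s ∷ s′ ∷ v)) +
    ∑ (words n) (λ v → ∑ (insertions s v) (f ∘ (s′ ∷_)))))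
    ≡⟨ trans (∑-cong traces (λ s → ∑-+ traces _ _)) (∑-+ traces _ _) ⟩
  ∑ traces (λ s → ∑ traces (λ s′ → ∑ (words n) (λ v → f (s ∷ s′ ∷ v)))) +
  ∑ traces (λ s → ∑ traces (λ s′ → ∑ (words n) (λ v → ∑ (insertions s v) (f ∘ (s′ ∷_)))))
    ≡⟨ cong₂ _+_
         (trans (∑-cong traces (λ s → sym (∑-words-suc n (f ∘ (s ∷_))))) (sym (∑-words-suc (suc n) f)))
         (trans (∑-swap traces traces _) (∑-cong traces (λ s′ → ∑-words-insertions n (f ∘ (s′ ∷_))))) ⟩
  ∑ (words (suc (suc n))) f + ∑ traces (λ s′ → suc n * ∑ (words (suc n)) (f ∘ (s′ ∷_)))
    ≡⟨ cong (∑ (words (suc (suc n))) f +_)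
         (trans (∑-* (suc n) traces _) (cong (suc n *_) (sym (∑-words-suc (suc n) f)))) ⟩
  suc (suc n) * ∑ (words (suc (suc n))) f ∎
  where open ≡-Reasoning

-- Each signed permutation of the places is a bijection on the words of length n, so it contributes
-- the plain sum of `f` once.
∑-words-orbit : ∀ n f → ∑ (words n) (λ w → ∑ (orbit flip w) f) ≡ orbitSize n * ∑ (words n) f
∑-words-orbit zero    f = trans (∑-words-zero (λ w → ∑ (orbit flip w) f))
  (cong (_+ 0) (trans (∑-orbit-[] flip f) (sym (∑-words-zero f))))
∑-words-orbit (suc n) f = begin
  ∑ (words (suc n)) (λ w → ∑ (orbit flip w) f)
    ≡⟨ ∑-words-suc n _ ⟩
  ∑ traces (λ s → ∑ (words n) (λ w → ∑ (orbit flip (s ∷ w)) f))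
    ≡⟨ ∑-cong traces (λ s → trans
         (∑-cong (words n) (λ w → ∑-orbit-∷ flip s w f)) (∑-words-orbit n (spread s f))) ⟩
  ∑ traces (λ s → orbitSize n * ∑ (words n) (spread s f))
    ≡⟨ ∑-* (orbitSize n) traces _ ⟩
  orbitSize n * ∑ traces (λ s → ∑ (words n) (spread s f))
    ≡⟨ cong (orbitSize n *_) (trans (∑-cong traces (λ s → ∑-+ (words n) _ _)) (∑-+ traces _ _)) ⟩
  orbitSize n * (∑ traces (λ s → ∑ (words n) (λ v → ∑ (insertions s v) f)) +
                 ∑ traces (λ s → ∑ (words n) (λ v → ∑ (insertions (flip s) v) f)))
    ≡⟨ cong (λ z → orbitSize n * (∑ traces ins + z)) (∑-traces-flip ins) ⟩
  orbitSize n * (∑ traces ins + ∑ traces ins)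
    ≡⟨ cong (λ z → orbitSize n * (z + z)) (∑-words-insertions n f) ⟩
  orbitSize n * (suc n * ∑ (words (suc n)) f + suc n * ∑ (words (suc n)) f)
    ≡⟨ lemma (orbitSize n) (suc n) (∑ (words (suc n)) f) ⟩
  orbitSize (suc n) * ∑ (words (suc n)) f ∎
  where
  open ≡-Reasoning
  ins : Trace → ℕ
  ins s = ∑ (words n) (λ v → ∑ (insertions s v) f)
  lemma : ∀ k m x → k * (m * x + m * x) ≡ k * (m + m) * x
  lemma = solve-∀

-- Compression of centres to left leaves.

∨-true : ∀ a b → a ∨ b ≡ true → a ≡ true ⊎ b ≡ true
∨-true true  b eq = inj₁ refl
∨-true false b eq = inj₂ eq

∧-true : ∀ a b → a ∧ b ≡ true → a ≡ true × b ≡ true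
∧-true true  b eq = refl , eq

∨-introʳ : ∀ a {b} → b ≡ true → a ∨ b ≡ true
∨-introʳ a refl = ∨-zeroʳ a

-- The shifting operator of extremal set theory, carried out at the last place first: the slices at
-- the various first letters are already compressed when they are combined.
compress : (Word → Bool) → Word → Bool
compress f []         = f []
compress f (left ∷ w) = compress (f ∘ (left ∷_)) w ∨ compress (f ∘ (mid ∷_)) w
compress f (mid ∷ w)  = compress (f ∘ (left ∷_)) w ∧ compress (f ∘ (mid ∷_)) w
compress f (s ∷ w)    = compress (f ∘ (s ∷_)) w

-- Compression only trades `mid` for `left`, and both have weight 1.
compress-source : ∀ f w → compress f w ≡ true →
  ∃[ v ] f v ≡ true × size v ≡ size w × length v ≡ length w
compress-source-∷ : ∀ f s s′ w → weight s ≡ weight s′ → compress (f ∘ (s ∷_)) w ≡ true →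
  ∃[ v ] f v ≡ true × size v ≡ size (s′ ∷ w) × length v ≡ length (s′ ∷ w)
compress-source f []          cw = [] , cw , refl , refl
compress-source f (none ∷ w)  cw = compress-source-∷ f none none w refl cw
compress-source f (right ∷ w) cw = compress-source-∷ f right right w refl cw
compress-source f (both ∷ w)  cw = compress-source-∷ f both both w refl cw
compress-source f (mid ∷ w)   cw =
  compress-source-∷ f mid mid w refl (proj₂ (∧-true (compress (f ∘ (left ∷_)) w) _ cw))
compress-source f (left ∷ w)  cw with ∨-true (compress (f ∘ (left ∷_)) w) _ cw
... | inj₁ cw′ = compress-source-∷ f left left w refl cw′
... | inj₂ cw′ = compress-source-∷ f mid left w refl cw′
compress-source-∷ f s s′ w eq cw with compress-source (f ∘ (s ∷_)) w cw
... | v , fv , sz , len = s ∷ v , fv , cong₂ _+_ eq sz , cong suc len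

-- Two families are needed even for a statement about one, since the induction passes to its slices
-- at two different first letters.
CrossMeet : (Trace → Trace → Bool) → (f g : Word → Bool) → Set
CrossMeet h f g = ∀ v w → f v ≡ true → g w ≡ true → meet h v w ≡ true

meet-[]ʳ : ∀ h v → meet h v [] ≡ false
meet-[]ʳ h []      = refl
meet-[]ʳ h (_ ∷ _) = refl

MissingHeads : (f g : Word → Bool) (v w : Word) → Set
MissingHeads f g v w = ∃₂ λ s s′ → hit s s′ ≡ false ×
  compress (f ∘ (s ∷_)) v ≡ true × compress (g ∘ (s′ ∷_)) w ≡ true

-- If mid is the common letter then shifting one of the two words to left
-- leaves a member of the original family that no longer meets the other there.
missingHeads : ∀ f g s s′ v w → leafHit s s′ ≡ false →
  compress f (s ∷ v) ≡ true → compress g (s′ ∷ w) ≡ true → MissingHeads f g v w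
missingHeads f g none none  v w _ cv cw = none , none , refl , cv , cw
missingHeads f g none right v w _ cv cw = none , right , refl , cv , cw
missingHeads f g none both  v w _ cv cw = none , both , refl , cv , cw
missingHeads f g none mid   v w _ cv cw = none , mid , refl , cv ,
  proj₂ (∧-true (compress (g ∘ (left ∷_)) w) _ cw)
missingHeads f g none left  v w _ cv cw with ∨-true (compress (g ∘ (left ∷_)) w) _ cw
... | inj₁ cw′ = none , left , refl , cv , cw′
... | inj₂ cw′ = none , mid , refl , cv , cw′
missingHeads f g right none v w _ cv cw = right , none , refl , cv , cw
missingHeads f g right mid  v w _ cv cw = right , mid , refl , cv ,
  proj₂ (∧-true (compress (g ∘ (left ∷_)) w) _ cw)
missingHeads f g right left v w _ cv cw with ∨-true (compress (g ∘ (left ∷_)) w) _ cw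
... | inj₁ cw′ = right , left , refl , cv , cw′
... | inj₂ cw′ = right , mid , refl , cv , cw′
missingHeads f g both none v w _ cv cw = both , none , refl , cv , cw
missingHeads f g both mid  v w _ cv cw = both , mid , refl , cv ,
  proj₂ (∧-true (compress (g ∘ (left ∷_)) w) _ cw)
missingHeads f g mid none  v w _ cv cw = mid , none , refl ,
  proj₂ (∧-true (compress (f ∘ (left ∷_)) v) _ cv) , cw
missingHeads f g mid right v w _ cv cw = mid , right , refl ,
  proj₂ (∧-true (compress (f ∘ (left ∷_)) v) _ cv) , cw
missingHeads f g mid both  v w _ cv cw = mid , both , refl ,
  proj₂ (∧-true (compress (f ∘ (left ∷_)) v) _ cv) , cw
missingHeads f g mid mid   v w _ cv cw = left , mid , refl ,
  proj₁ (∧-true (compress (f ∘ (left ∷_)) v) _ cv) ,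
  proj₂ (∧-true (compress (g ∘ (left ∷_)) w) _ cw)
missingHeads f g mid left  v w _ cv cw with ∨-true (compress (g ∘ (left ∷_)) w) _ cw
... | inj₁ cw′ = mid , left , refl , proj₂ (∧-true (compress (f ∘ (left ∷_)) v) _ cv) , cw′
... | inj₂ cw′ = left , mid , refl , proj₁ (∧-true (compress (f ∘ (left ∷_)) v) _ cv) , cw′
missingHeads f g left none  v w _ cv cw with ∨-true (compress (f ∘ (left ∷_)) v) _ cv
... | inj₁ cv′ = left , none , refl , cv′ , cw
... | inj₂ cv′ = mid , none , refl , cv′ , cw
missingHeads f g left right v w _ cv cw with ∨-true (compress (f ∘ (left ∷_)) v) _ cv
... | inj₁ cv′ = left , right , refl , cv′ , cw
... | inj₂ cv′ = mid , right , refl , cv′ , cw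
missingHeads f g left mid   v w _ cv cw with ∨-true (compress (f ∘ (left ∷_)) v) _ cv
... | inj₁ cv′ = left , mid , refl , cv′ , proj₂ (∧-true (compress (g ∘ (left ∷_)) w) _ cw)
... | inj₂ cv′ = mid , left , refl , cv′ , proj₁ (∧-true (compress (g ∘ (left ∷_)) w) _ cw)

-- If the first letters share no leaf, they can be traded for first letters that do not meet at all.
-- Whatever lies in the corresponding slices of `f` and `g` must then meet in the tails, and the
-- induction applies to these slices.
compress-crossMeet : ∀ f g → CrossMeet hit f g → CrossMeet leafHit (compress f) (compress g)
compress-crossMeet f g cross []      w  cv cw with compress-source g w cw
... | w′ , gw′ , _ = contradiction (cross [] w′ cv gw′) λ ()
compress-crossMeet f g cross (s ∷ v) [] cv cw with compress-source f (s ∷ v) cv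
... | v′ , fv′ , _ =
  contradiction (trans (sym (meet-[]ʳ hit v′)) (cross v′ [] fv′ cw)) λ ()
compress-crossMeet f g cross (s ∷ v) (s′ ∷ w) cv cw with leafHit s s′ in eq
... | true  = refl
... | false with missingHeads f g s s′ v w eq cv cw
... | t , t′ , miss , cv′ , cw′ =
  compress-crossMeet (f ∘ (t ∷_)) (g ∘ (t′ ∷_))
    (λ v′ w′ fv gw → subst (λ b → b ∨ meet hit v′ w′ ≡ true) miss
      (cross (t ∷ v′) (t′ ∷ w′) fv gw)) v w cv′ cw′

𝟙-∨-∧ : ∀ a b → 𝟙 (a ∨ b) + 𝟙 (a ∧ b) ≡ 𝟙 a + 𝟙 b
𝟙-∨-∧ true  true  = refl
𝟙-∨-∧ true  false = refl
𝟙-∨-∧ false true  = refl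
𝟙-∨-∧ false false = refl

-- The compressed slices at `left` and `mid` are replaced by their union and intersection, which
-- have the same total size.
∑-compress : ∀ n f → ∑ (words n) (𝟙 ∘ compress f) ≡ ∑ (words n) (𝟙 ∘ f)
∑-compress zero    f = trans (∑-words-zero (𝟙 ∘ compress f)) (sym (∑-words-zero (𝟙 ∘ f)))
∑-compress (suc n) f = begin
  ∑ (words (suc n)) (𝟙 ∘ compress f)
    ≡⟨ trans (∑-words-suc n _) (∑-traces _) ⟩
  Σ (compress (f ∘ (both ∷_))) + (Σ (λ w → l w ∨ m w) + (Σ (λ w → l w ∧ m w) +
    (Σ (compress (f ∘ (right ∷_))) + (Σ (compress (f ∘ (none ∷_))) + 0))))
    ≡⟨ cong (Σ (compress (f ∘ (both ∷_))) +_) (trans (sym (+-assoc (Σ (λ w → l w ∨ m w)) _ _))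
         (trans (cong (_+ (Σ (compress (f ∘ (right ∷_))) + (Σ (compress (f ∘ (none ∷_))) + 0))) shifted)
                (+-assoc (Σ l) (Σ m) _))) ⟩
  Σ (compress (f ∘ (both ∷_))) + (Σ l + (Σ m +
    (Σ (compress (f ∘ (right ∷_))) + (Σ (compress (f ∘ (none ∷_))) + 0))))
    ≡⟨ ∑-traces (λ s → Σ (compress (f ∘ (s ∷_)))) ⟨
  ∑ traces (λ s → Σ (compress (f ∘ (s ∷_))))
    ≡⟨ ∑-cong traces (λ s → ∑-compress n (f ∘ (s ∷_))) ⟩
  ∑ traces (λ s → ∑ (words n) (𝟙 ∘ f ∘ (s ∷_)))
    ≡⟨ ∑-words-suc n (𝟙 ∘ f) ⟨
  ∑ (words (suc n)) (𝟙 ∘ f) ∎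
  where
  open ≡-Reasoning
  l m : Word → Bool
  l = compress (f ∘ (left ∷_))
  m = compress (f ∘ (mid ∷_))
  Σ : (Word → Bool) → ℕ
  Σ g = ∑ (words n) (𝟙 ∘ g)
  shifted : Σ (λ w → l w ∨ m w) + Σ (λ w → l w ∧ m w) ≡ Σ l + Σ m
  shifted = trans (sym (∑-+ (words n) _ _))
    (trans (∑-cong (words n) (λ w → 𝟙-∨-∧ (l w) (m w))) (∑-+ (words n) _ _))

-- Katona's counting argument on a circle.

∑-upTo-suc : ∀ n (g : ℕ → ℕ) → ∑ (upTo (suc n)) g ≡ g 0 + ∑ (upTo n) (g ∘ suc)
∑-upTo-suc n g = cong (g 0 +_) (trans (cong (λ xs → ∑ xs g) (sym (map-applyUpTo id suc n)))
  (∑-map suc (upTo n) g))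

∑-upTo-+ : ∀ m n (g : ℕ → ℕ) →
  ∑ (upTo (m + n)) g ≡ ∑ (upTo m) g + ∑ (upTo n) (λ i → g (m + i))
∑-upTo-+ zero    n g = refl
∑-upTo-+ (suc m) n g = begin
  ∑ (upTo (suc (m + n))) g
    ≡⟨ ∑-upTo-suc (m + n) g ⟩
  g 0 + ∑ (upTo (m + n)) (g ∘ suc)
    ≡⟨ cong (g 0 +_) (∑-upTo-+ m n (g ∘ suc)) ⟩
  g 0 + (∑ (upTo m) (g ∘ suc) + ∑ (upTo n) (λ i → g (suc m + i)))
    ≡⟨ +-assoc (g 0) _ _ ⟨
  (g 0 + ∑ (upTo m) (g ∘ suc)) + ∑ (upTo n) (λ i → g (suc m + i))
    ≡⟨ cong (_+ ∑ (upTo n) (λ i → g (suc m + i))) (∑-upTo-suc m g) ⟨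
  ∑ (upTo (suc m)) g + ∑ (upTo n) (λ i → g (suc m + i)) ∎
  where open ≡-Reasoning

upTo-< : ∀ n → All (_< n) (upTo n)
upTo-< n = applyUpTo⁺₁ id n id

-- The hypothesis forbids both i and i + d for every circular distance d ∈ [t , k − t].
-- Starting at a member 0, all others lie in (0 , t) or (k − t , k), and these
-- positions are matched into the t forbidden pairs {i , i + (k − t)}.
katona : ∀ (J : ℕ → Bool) t c → (let k = t + (c + t)) →
  (∀ i d → t ≤ d → d + t ≤ k → J i ≡ true → J (i + d) ≡ false) →
  ∀ m → m ≤ k → ∑ (upTo m) (𝟙 ∘ J) ≤ t
katona J t c sep zero    m≤k = z≤n
katona J t c sep (suc m) m≤k = byHead (J 0) refl
  where
  open ≤-Reasoning
  middle : J 0 ≡ true → ∀ i → i < c → 𝟙 (J (t + i)) ≡ 0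
  middle J0 i i<c = cong 𝟙 (sep 0 (t + i) (m≤m+n t i)
    (≤-trans (≤-reflexive (+-assoc t i t)) (+-monoʳ-≤ t (+-monoˡ-≤ t (<⇒≤ i<c)))) J0)
  paired : ∀ i → 𝟙 (J i) + 𝟙 (J (t + (c + i))) ≤ 1
  paired i with J i in Ji
  ... | true  = ≤-reflexive (cong (λ b → suc (𝟙 b)) (trans (cong J (lemma t c i))
        (sep i (t + c) (m≤m+n t c) (≤-reflexive (+-assoc t c t)) Ji)))
    where
    lemma : ∀ t c i → t + (c + i) ≡ i + (t + c)
    lemma = solve-∀
  ... | false with J (t + (c + i))
  ... | true  = ≤-refl
  ... | false = z≤n
  byHead : ∀ b → J 0 ≡ b → ∑ (upTo (suc m)) (𝟙 ∘ J) ≤ t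
  byHead false J0 = begin
    ∑ (upTo (suc m)) (𝟙 ∘ J)        ≡⟨ ∑-upTo-suc m (𝟙 ∘ J) ⟩
    𝟙 (J 0) + ∑ (upTo m) (𝟙 ∘ J ∘ suc) ≡⟨ cong (λ b → 𝟙 b + ∑ (upTo m) (𝟙 ∘ J ∘ suc)) J0 ⟩
    ∑ (upTo m) (𝟙 ∘ J ∘ suc)
      -- The hypothesis is invariant under translation, so the window simply moves on to its first
      -- member without wrapping around.
      ≤⟨ katona (J ∘ suc) t c (λ i d → sep (suc i) d) m (≤-trans (n≤1+n m) m≤k) ⟩
    t ∎
  byHead true J0 with m≤n⇒∃[o]m+o≡n m≤k
  ... | o , m+o≡k = begin
    -- The window may grow to a full turn: counted from the member at 0, even all k positions hold
    -- at most t members.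
    ∑ (upTo (suc m)) (𝟙 ∘ J)
      ≤⟨ m≤m+n _ _ ⟩
    ∑ (upTo (suc m)) (𝟙 ∘ J) + ∑ (upTo o) (λ i → 𝟙 (J (suc m + i)))
      ≡⟨ ∑-upTo-+ (suc m) o (𝟙 ∘ J) ⟨
    ∑ (upTo (suc m + o)) (𝟙 ∘ J)
      ≡⟨ cong (λ z → ∑ (upTo z) (𝟙 ∘ J)) m+o≡k ⟩
    ∑ (upTo (t + (c + t))) (𝟙 ∘ J)
      ≡⟨ trans (∑-upTo-+ t (c + t) (𝟙 ∘ J))
           (cong (∑ (upTo t) (𝟙 ∘ J) +_) (∑-upTo-+ c t (λ i → 𝟙 (J (t + i))))) ⟩
    ∑ (upTo t) (𝟙 ∘ J) + (∑ (upTo c) (λ i → 𝟙 (J (t + i))) + ∑ (upTo t) (λ i → 𝟙 (J (t + (c + i)))))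
      ≡⟨ cong (λ z → ∑ (upTo t) (𝟙 ∘ J) + (z + ∑ (upTo t) (λ i → 𝟙 (J (t + (c + i))))))
           (trans (∑-congᴬ (All.map (λ {i} → middle J0 i) (upTo-< c))) (∑-0 (upTo c))) ⟩
    ∑ (upTo t) (𝟙 ∘ J) + ∑ (upTo t) (λ i → 𝟙 (J (t + (c + i))))
      ≡⟨ ∑-+ (upTo t) _ _ ⟨
    ∑ (upTo t) (λ i → 𝟙 (J i) + 𝟙 (J (t + (c + i))))
      ≤⟨ ∑-bound (All.map (λ {i} _ → paired i) (upTo-< t)) ⟩
    length (upTo t) * 1
      ≡⟨ trans (*-identityʳ _) (length-upTo t) ⟩
    t ∎

-- The circular arrangement of a word and its two readings.

singles doubles : Word → ℕ
singles []          = 0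
singles (left ∷ w)  = suc (singles w)
singles (right ∷ w) = suc (singles w)
singles (_ ∷ w)     = singles w
doubles []         = 0
doubles (both ∷ w) = suc (doubles w)
doubles (_ ∷ w)    = doubles w

leafless : Word → Word
leafless []         = []
leafless (none ∷ w) = none ∷ leafless w
leafless (mid ∷ w)  = mid ∷ leafless w
leafless (_ ∷ w)    = leafless w

sorted : ℕ → ℕ → Word → Word
sorted a p z = replicate a left ++ (replicate p both ++ z)

sorted-leafless : ∀ s a p z → sorted a p (s ∷ z) ↭ s ∷ sorted a p z
sorted-leafless s a p z = ↭-trans
  (++⁺ˡ (replicate a left) (↭-shift (replicate p both) z))
  (↭-shift (replicate a left) (replicate p both ++ z))

↭-sorted : ∀ w → w ↭ sorted (singles w) (doubles w) (leafless w)
↭-sorted []          = ↭-refl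
↭-sorted (none ∷ w)  = ↭-trans (↭-prep none (↭-sorted w))
  (↭-sym (sorted-leafless none (singles w) (doubles w) (leafless w)))
↭-sorted (mid ∷ w)   = ↭-trans (↭-prep mid (↭-sorted w))
  (↭-sym (sorted-leafless mid (singles w) (doubles w) (leafless w)))
↭-sorted (left ∷ w)  = prep refl (↭-sorted w)
↭-sorted (right ∷ w) = prep refl (↭-sorted w)
↭-sorted (both ∷ w)  = ↭-trans (↭-prep both (↭-sorted w))
  (↭-sym (↭-shift (replicate (singles w) left) (replicate (doubles w) both ++ leafless w)))

evens odds : List A → List A
evens []       = []
evens (x ∷ xs) = x ∷ odds xs
odds []       = []
odds (x ∷ xs) = evens xs

twice : List A → List A
twice []       = []
twice (x ∷ xs) = x ∷ x ∷ twice xs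

evens-twice : ∀ (xs : List A) → evens (twice xs) ≡ xs
evens-twice []       = refl
evens-twice (x ∷ xs) = cong (x ∷_) (evens-twice xs)

odds-twice : ∀ (xs : List A) → odds (twice xs) ≡ xs
odds-twice []       = refl
odds-twice (x ∷ xs) = cong (x ∷_) (odds-twice xs)

-- The letters with a right leaf, and those with a left leaf, both form an
-- interval of length a + p * 2, the latter starting at position a.
circle : ℕ → ℕ → Word → Word
circle a p z = replicate a right ++ (replicate (p * 2) both ++ (replicate a left ++ z))

replicate-∷ : ∀ n (x : A) xs → replicate n x ++ (x ∷ xs) ≡ x ∷ (replicate n x ++ xs)
replicate-∷ zero    x xs = refl
replicate-∷ (suc n) x xs = cong (x ∷_) (replicate-∷ n x xs)

circle-suc : ∀ a p z → circle (suc a) p z ≡ right ∷ circle a p (left ∷ z)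
circle-suc a p z = cong (λ y → right ∷ (replicate a right ++ (replicate (p * 2) both ++ y)))
  (sym (replicate-∷ a left z))

-- Peeling off the first `right` and the last `left` of `circle (suc a) p z` removes positions 0 and
-- 2a + 2p + 1. They have opposite parity, so each reading loses one single. The rest moves by one
-- position, which makes the two readings recurse into each other.
evens-circle : ∀ a p z → evens (circle a p z) ↭ sorted a p (evens z)
odds-circle  : ∀ a p z → odds (circle a p z) ↭ sorted a p (odds z)
evens-circle zero zero    z = ↭-refl
evens-circle zero (suc p) z = ↭-prep both (evens-circle zero p z)
evens-circle (suc a) p z = ↭-trans (↭-reflexive (cong evens (circle-suc a p z)))
  (prep refl (odds-circle a p (left ∷ z)))
odds-circle zero zero    z = ↭-refl
odds-circle zero (suc p) z = ↭-prep both (odds-circle zero p z)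
odds-circle (suc a) p z = ↭-trans (↭-reflexive (cong odds (circle-suc a p z)))
  (↭-trans (evens-circle a p (left ∷ z)) (sorted-leafless left a p (odds z)))

-- The default `none` has no leaf, so the bounds on the positions of leaves hold beyond the end of
-- the word too.
nth : Word → ℕ → Trace
nth []      _       = none
nth (s ∷ w) zero    = s
nth (s ∷ w) (suc i) = nth w i

applyUpTo-nth : ∀ w → applyUpTo (nth w) (length w) ≡ w
applyUpTo-nth []      = refl
applyUpTo-nth (s ∷ w) = cong (s ∷_) (applyUpTo-nth w)

applyUpTo-cong : ∀ {f g : ℕ → A} n → (∀ i → i < n → f i ≡ g i) → applyUpTo f n ≡ applyUpTo g n
applyUpTo-cong zero    f≗g = refl
applyUpTo-cong (suc n) f≗g = cong₂ _∷_ (f≗g 0 (s≤s z≤n)) (applyUpTo-cong n (λ i i<n → f≗g (suc i) (s≤s i<n)))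

evens-applyUpTo : ∀ (g : ℕ → A) n → evens (applyUpTo g (n * 2)) ≡ applyUpTo (λ q → g (q * 2)) n
evens-applyUpTo g zero    = refl
evens-applyUpTo g (suc n) = cong (g 0 ∷_) (evens-applyUpTo (λ i → g (2 + i)) n)

odds-applyUpTo : ∀ (g : ℕ → A) n → odds (applyUpTo g (n * 2)) ≡ applyUpTo (λ q → g (suc (q * 2))) n
odds-applyUpTo g zero    = refl
odds-applyUpTo g (suc n) = cong (g 1 ∷_) (odds-applyUpTo (λ i → g (2 + i)) n)

applyUpTo-rotate : ∀ (g : ℕ → Trace) n → g n ≡ g 0 → applyUpTo (g ∘ suc) n ↭ applyUpTo g n
applyUpTo-rotate g zero    eq = ↭-refl
applyUpTo-rotate g (suc n) eq = ↭-trans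
  (↭-reflexive (trans (sym (applyUpTo-∷ʳ (g ∘ suc) n)) (cong (λ s → applyUpTo (g ∘ suc) n ++ s ∷ []) eq)))
  (↭-trans (↭-shift (applyUpTo (g ∘ suc) n) [])
    (↭-reflexive (cong (g 0 ∷_) (++-identityʳ (applyUpTo (g ∘ suc) n)))))

module _ (g : ℕ → Trace) (n : ℕ) where

  alternate : ℕ → Word
  alternate i = applyUpTo (λ q → g (q * 2 + i)) n

  -- Starting two positions later moves the first letter to the end, by periodicity; this leaves
  -- only the starts 0 and 1.
  alternate-↭ : (∀ i → g (n * 2 + i) ≡ g i) →
    ∀ {w} → alternate 0 ↭ w → alternate 1 ↭ w → ∀ i → alternate i ↭ w
  alternate-↭ periodic w₀ w₁ zero          = w₀
  alternate-↭ periodic w₀ w₁ (suc zero)    = w₁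
  alternate-↭ periodic w₀ w₁ (suc (suc i)) = ↭-trans
    (↭-reflexive (applyUpTo-cong n (λ q _ → cong g (lemma (q * 2) i))))
    (↭-trans (applyUpTo-rotate (λ q → g (q * 2 + i)) n (periodic i)) (alternate-↭ periodic w₀ w₁ i))
    where
    lemma : ∀ x i → x + suc (suc i) ≡ suc (suc (x + i))
    lemma = solve-∀

-- The arcs of left and right leaves.

nth-< : ∀ (P : Trace → Bool) a s z b → (∀ i → P (nth z i) ≡ true → i < b) →
  ∀ i → P (nth (replicate a s ++ z) i) ≡ true → i < a + b
nth-< P zero    s z b bnd i       eq = bnd i eq
nth-< P (suc a) s z b bnd zero    eq = s≤s z≤n
nth-< P (suc a) s z b bnd (suc i) eq = s≤s (nth-< P a s z b bnd i eq)

nth-≥ : ∀ (P : Trace → Bool) a s z → P s ≡ false →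
  ∀ i → P (nth (replicate a s ++ z) i) ≡ true → a ≤ i
nth-≥ P zero    s z ¬Ps i       eq = z≤n
nth-≥ P (suc a) s z ¬Ps zero    eq = contradiction (trans (sym ¬Ps) eq) λ ()
nth-≥ P (suc a) s z ¬Ps (suc i) eq = s≤s (nth-≥ P a s z ¬Ps i eq)

nth-none : ∀ (P : Trace → Bool) {z} → P none ≡ false → All (λ s → P s ≡ false) z →
  ∀ i → P (nth z i) ≡ true → i < 0
nth-none P ¬Pnone []         i       eq = contradiction (trans (sym ¬Pnone) eq) λ ()
nth-none P ¬Pnone (¬Ps ∷ _)  zero    eq = contradiction (trans (sym ¬Ps) eq) λ ()
nth-none P ¬Pnone (_ ∷ ¬Pz)  (suc i) eq = contradiction (nth-none P ¬Pnone ¬Pz i eq) λ ()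

Leafless : Trace → Set
Leafless s = hasLeft s ≡ false × hasRight s ≡ false

leafless-twice : ∀ w → All Leafless (twice (leafless w))
leafless-twice []          = []
leafless-twice (none ∷ w)  = (refl , refl) ∷ (refl , refl) ∷ leafless-twice w
leafless-twice (mid ∷ w)   = (refl , refl) ∷ (refl , refl) ∷ leafless-twice w
leafless-twice (left ∷ w)  = leafless-twice w
leafless-twice (right ∷ w) = leafless-twice w
leafless-twice (both ∷ w)  = leafless-twice w

circle-right : ∀ a p {z} → All Leafless z → ∀ i → hasRight (nth (circle a p z) i) ≡ true → i < a + p * 2
circle-right a p {z} lz i eq = subst (i <_) (cong (a +_) (+-identityʳ (p * 2)))
  (nth-< hasRight a right _ _ (nth-< hasRight (p * 2) both _ _
    (nth-none hasRight refl (++⁺ (replicate⁺ a refl) (All.map proj₂ lz)))) i eq)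

circle-left : ∀ a p {z} → All Leafless z → ∀ i → hasLeft (nth (circle a p z) i) ≡ true →
  a ≤ i × i < a + (a + p * 2)
circle-left a p {z} lz i eq = nth-≥ hasLeft a right _ refl i eq ,
  subst (i <_) (lemma a (p * 2)) (nth-< hasLeft a right _ _
    (nth-< hasLeft (p * 2) both _ _ (nth-< hasLeft a left z 0
      (nth-none hasLeft refl (All.map proj₁ lz)))) i eq)
  where
  lemma : ∀ a q → a + (q + (a + 0)) ≡ a + (a + q)
  lemma = solve-∀

-- Without wrapping around, a step of at least t from inside the arc leads past its end. With
-- wrapping around, d at most k - t keeps the point short of its beginning `lo`.
interval-separated : ∀ k .{{_ : NonZero k}} lo t u d → u < k → t ≤ d → d + t ≤ k →
  lo ≤ u → u < lo + t → lo ≤ (u + d) % k → (u + d) % k < lo + t → ⊥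
interval-separated k lo t u d u<k t≤d d+t≤k lo≤u u<lo+t lo≤v v<lo+t with u + d <? k
... | yes u+d<k = <⇒≱ v<lo+t (begin
  lo + t      ≤⟨ +-mono-≤ lo≤u t≤d ⟩
  u + d       ≡⟨ m<n⇒m%n≡m u+d<k ⟨
  (u + d) % k ∎)
  where open ≤-Reasoning
... | no u+d≮k with m≤n⇒∃[o]m+o≡n (≮⇒≥ u+d≮k)
... | v , k+v≡u+d = <⇒≱ v<lo (subst (lo ≤_)
  (trans (cong (_% k) (sym v+k≡u+d)) (trans ([m+n]%n≡m%n v k) (m<n⇒m%n≡m v<k))) lo≤v)
  where
  open ≤-Reasoning
  v+k≡u+d : v + k ≡ u + d
  v+k≡u+d = trans (+-comm v k) k+v≡u+d
  v<lo : v < lo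
  v<lo = +-cancelʳ-< k v lo (begin-strict
    v + k       ≡⟨ v+k≡u+d ⟩
    u + d       <⟨ +-monoˡ-< d u<lo+t ⟩
    lo + t + d  ≡⟨ trans (+-assoc lo t d) (cong (lo +_) (+-comm t d)) ⟩
    lo + (d + t) ≤⟨ +-monoʳ-≤ lo d+t≤k ⟩
    lo + k      ∎)
  v<k : v < k
  v<k = <-trans v<lo (≤-<-trans lo≤u u<k)

module _ (a p : ℕ) {z : Word} (lz : All Leafless z) (k : ℕ) .{{_ : NonZero k}} where

  private t = a + p * 2

  around : ℕ → Trace
  around i = nth (circle a p z) (i % k)

  -- A common left leaf would put both positions into the arc starting at a, a common right leaf
  -- into the arc starting at 0; both arcs have length t.
  around-separated : ∀ i d → t ≤ d → d + t ≤ k → leafHit (around i) (around (i + d)) ≡ false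
  around-separated i d t≤d d+t≤k = ∨-false
    (∧-false (λ l l′ → clash a (proj₁ (lft i l)) (proj₂ (lft i l))
      (proj₁ (lft (i + d) l′)) (proj₂ (lft (i + d) l′))))
    (∧-false (λ r r′ → clash 0 z≤n (rgt i r) z≤n (rgt (i + d) r′)))
    where
    lft : ∀ j → hasLeft (around j) ≡ true → a ≤ j % k × j % k < a + t
    lft j = circle-left a p lz (j % k)
    rgt : ∀ j → hasRight (around j) ≡ true → j % k < t
    rgt j = circle-right a p lz (j % k)
    shifted : (i + d) % k ≡ (i % k + d) % k
    shifted = trans (%-distribˡ-+ i d k)
      (trans (cong (λ x → (x + d % k) % k) (sym (m%n%n≡m%n i k))) (sym (%-distribˡ-+ (i % k) d k)))
    clash : ∀ lo → lo ≤ i % k → i % k < lo + t → lo ≤ (i + d) % k → (i + d) % k < lo + t → ⊥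
    clash lo b₁ b₂ b₃ b₄ = interval-separated k lo t (i % k) d (m%n<n i k) t≤d d+t≤k b₁ b₂
      (subst (lo ≤_) shifted b₃) (subst (_< lo + t) shifted b₄)
    ∧-false : ∀ {x y} → (x ≡ true → y ≡ true → ⊥) → x ∧ y ≡ false
    ∧-false {true}  {true}  h = ⊥-elim (h refl refl)
    ∧-false {true}  {false} h = refl
    ∧-false {false} {y}     h = refl
    ∨-false : ∀ {x y} → x ≡ false → y ≡ false → x ∨ y ≡ false
    ∨-false refl refl = refl

-- Letter counts, and the bound within one orbit.

leaves-singles-doubles : ∀ w → leaves w ≡ singles w + doubles w * 2
leaves-singles-doubles []          = refl
leaves-singles-doubles (none ∷ w)  = leaves-singles-doubles w
leaves-singles-doubles (mid ∷ w)   = leaves-singles-doubles w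
leaves-singles-doubles (left ∷ w)  = cong suc (leaves-singles-doubles w)
leaves-singles-doubles (right ∷ w) = cong suc (leaves-singles-doubles w)
leaves-singles-doubles (both ∷ w)  = trans (cong (2 +_) (leaves-singles-doubles w))
  (lemma (singles w) (doubles w * 2))
  where
  lemma : ∀ x y → 2 + (x + y) ≡ x + (2 + y)
  lemma = solve-∀

length-split : ∀ w → length w ≡ singles w + (doubles w + length (leafless w))
length-split []          = refl
length-split (left ∷ w)  = cong suc (length-split w)
length-split (right ∷ w) = cong suc (length-split w)
length-split (none ∷ w)  = trans (cong suc (length-split w))
  (lemma (singles w) (doubles w) (length (leafless w)))
  where
  lemma : ∀ x y z → suc (x + (y + z)) ≡ x + (y + suc z)
  lemma = solve-∀
length-split (mid ∷ w)   = trans (cong suc (length-split w))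
  (lemma (singles w) (doubles w) (length (leafless w)))
  where
  lemma : ∀ x y z → suc (x + (y + z)) ≡ x + (y + suc z)
  lemma = solve-∀
length-split (both ∷ w)  = trans (cong suc (length-split w))
  (sym (+-suc (singles w) (doubles w + length (leafless w))))

length-twice : ∀ (xs : List A) → length (twice xs) ≡ length xs * 2
length-twice []       = refl
length-twice (x ∷ xs) = cong (2 +_) (length-twice xs)

length-circle : ∀ w →
  length (circle (singles w) (doubles w) (twice (leafless w))) ≡ length w * 2
length-circle w = begin
  length (circle a p (twice z))
    ≡⟨ trans (length-++ (replicate a right) {replicate (p * 2) both ++ (replicate a left ++ twice z)})
         (cong₂ _+_ (length-replicate a)
         (trans (length-++ (replicate (p * 2) both)) (cong₂ _+_ (length-replicate (p * 2))
           (trans (length-++ (replicate a left)) (cong₂ _+_ (length-replicate a) (length-twice z)))))) ⟩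
  a + (p * 2 + (a + length z * 2))
    ≡⟨ lemma a p (length z) ⟩
  (a + (p + length z)) * 2
    ≡⟨ cong (_* 2) (length-split w) ⟨
  length w * 2 ∎
  where
  open ≡-Reasoning
  a p : ℕ
  a = singles w
  p = doubles w
  z : Word
  z = leafless w
  lemma : ∀ a p z → a + (p * 2 + (a + z * 2)) ≡ (a + (p + z)) * 2
  lemma = solve-∀

hasLeft-flip : ∀ s → hasLeft (flip s) ≡ hasRight s
hasLeft-flip none  = refl
hasLeft-flip mid   = refl
hasLeft-flip left  = refl
hasLeft-flip right = refl
hasLeft-flip both  = refl

hasRight-flip : ∀ s → hasRight (flip s) ≡ hasLeft s
hasRight-flip none  = refl
hasRight-flip mid   = refl
hasRight-flip left  = refl
hasRight-flip right = refl
hasRight-flip both  = refl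

leafHit-flip : ∀ s s′ → leafHit (flip s) (flip s′) ≡ leafHit s s′
leafHit-flip s s′
  rewrite hasLeft-flip s | hasLeft-flip s′ | hasRight-flip s | hasRight-flip s′
  = ∨-comm (hasRight s ∧ hasRight s′) (hasLeft s ∧ hasLeft s′)

meet-columns : ∀ i j (V : List (ℕ → Trace)) → All (λ col → leafHit (col i) (col j) ≡ false) V →
  meet leafHit (map (_$ i) V) (map (_$ j) V) ≡ false
meet-columns i j []        []         = refl
meet-columns i j (col ∷ V) (eq ∷ eqs) rewrite eq = meet-columns i j V eqs

module _ (w : Word) .{{_ : NonZero (length w)}} where

  private
    n k t a p : ℕ
    n = length w
    k = n * 2
    a = singles w
    p = doubles w
    t = a + p * 2
    z : Word
    z = leafless w
    instance
      k≢0 : NonZero k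
      k≢0 = m*n≢0 n 2
    γ : ℕ → Trace
    γ = around a p (leafless-twice w) k
    γ-circle : applyUpTo γ k ≡ circle a p (twice z)
    γ-circle = begin
      applyUpTo γ k
        ≡⟨ applyUpTo-cong k (λ i i<k → cong (nth (circle a p (twice z))) (m<n⇒m%n≡m i<k)) ⟩
      applyUpTo (nth (circle a p (twice z))) k
        ≡⟨ cong (applyUpTo (nth (circle a p (twice z)))) (length-circle w) ⟨
      applyUpTo (nth (circle a p (twice z))) (length (circle a p (twice z)))
        ≡⟨ applyUpTo-nth (circle a p (twice z)) ⟩
      circle a p (twice z) ∎
      where open ≡-Reasoning
    periodic : ∀ i → γ (k + i) ≡ γ i
    periodic i = cong (nth (circle a p (twice z))) (trans (cong (_% k) (+-comm k i)) ([m+n]%n≡m%n i k))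
    rotation-↭ : ∀ i → alternate γ n i ↭ w
    rotation-↭ = alternate-↭ γ n periodic
      (↭-trans (↭-reflexive (begin
          applyUpTo (λ q → γ (q * 2 + 0)) n ≡⟨ applyUpTo-cong n (λ q _ → cong γ (+-identityʳ (q * 2))) ⟩
          applyUpTo (λ q → γ (q * 2)) n     ≡⟨ evens-applyUpTo γ n ⟨
          evens (applyUpTo γ k)             ≡⟨ cong evens γ-circle ⟩
          evens (circle a p (twice z))      ∎))
        (↭-trans (evens-circle a p (twice z))
          (↭-trans (↭-reflexive (cong (sorted a p) (evens-twice z))) (↭-sym (↭-sorted w)))))
      (↭-trans (↭-reflexive (begin
          applyUpTo (λ q → γ (q * 2 + 1)) n   ≡⟨ applyUpTo-cong n (λ q _ → cong γ (+-comm (q * 2) 1)) ⟩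
          applyUpTo (λ q → γ (suc (q * 2))) n ≡⟨ odds-applyUpTo γ n ⟨
          odds (applyUpTo γ k)                ≡⟨ cong odds γ-circle ⟩
          odds (circle a p (twice z))         ∎))
        (↭-trans (odds-circle a p (twice z))
          (↭-trans (↭-reflexive (cong (sorted a p) (odds-twice z))) (↭-sym (↭-sorted w)))))
      where open ≡-Reasoning
    -- Each column lists the letters of all rotations at one position, so that a
    -- permutation or flip of columns acts on all rotations simultaneously.
    columns : List (ℕ → Trace)
    columns = applyUpTo (λ q i → γ (q * 2 + i)) n
    Separated : (ℕ → Trace) → Set
    Separated col = ∀ i d → t ≤ d → d + t ≤ k → leafHit (col i) (col (i + d)) ≡ false
    columns-separated : All Separated columns
    columns-separated = applyUpTo⁺₂ (λ q i → γ (q * 2 + i)) n (λ q i d t≤d d+t≤k →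
      subst (λ j → leafHit (γ (q * 2 + i)) (γ j) ≡ false) (+-assoc (q * 2) i d)
        (around-separated a p (leafless-twice w) k (q * 2 + i) d t≤d d+t≤k))

  -- All 2n rotations rearrange `w`, so each has the orbit sum of `w`. Exchanging the sums fixes a
  -- signed permutation of the columns and counts the rotations that it carries into the family;
  -- separation survives the permutation, so there are at most t.
  ∑-orbit-bound : ∀ f → CrossMeet leafHit f f → leaves w ≤ length w →
    length w * 2 * ∑ (orbit flip w) (𝟙 ∘ f) ≤ orbitSize (length w) * leaves w
  ∑-orbit-bound f cross leaves≤n with m≤n⇒∃[o]m+o≡n (subst (_≤ n) (leaves-singles-doubles w) leaves≤n)
  ... | o , t+o≡n = begin
    k * ∑ (orbit flip w) (𝟙 ∘ f)
      ≡⟨ cong (_* ∑ (orbit flip w) (𝟙 ∘ f)) (length-applyUpTo id k) ⟨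
    length (upTo k) * ∑ (orbit flip w) (𝟙 ∘ f)
      ≡⟨ ∑-const (upTo k) _ ⟨
    ∑ (upTo k) (λ i → ∑ (orbit flip w) (𝟙 ∘ f))
      ≡⟨ ∑-cong (upTo k) rotate ⟩
    ∑ (upTo k) (λ i → ∑ (orbit (flip ∘_) columns) (λ V → 𝟙 (f (map (_$ i) V))))
      ≡⟨ ∑-swap (upTo k) (orbit (flip ∘_) columns) (λ i V → 𝟙 (f (map (_$ i) V))) ⟩
    ∑ (orbit (flip ∘_) columns) (λ V → ∑ (upTo k) (λ i → 𝟙 (f (map (_$ i) V))))
      ≤⟨ ∑-bound (All.map (λ {V} → bound {V})
           (orbit-All {P = Separated} (λ {col} → separated-flip {col}) columns-separated)) ⟩
    length (orbit (flip ∘_) columns) * t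
      ≡⟨ cong₂ _*_ (trans (length-orbit (flip ∘_) columns) (cong orbitSize (length-applyUpTo _ n)))
                   (sym (leaves-singles-doubles w)) ⟩
    orbitSize n * leaves w ∎
    where
    open ≤-Reasoning
    rotate : ∀ i → ∑ (orbit flip w) (𝟙 ∘ f) ≡
      ∑ (orbit (flip ∘_) columns) (λ V → 𝟙 (f (map (_$ i) V)))
    rotate i = trans (∑-orbit-↭ (↭-sym (rotation-↭ i)) (𝟙 ∘ f))
      (trans (cong (λ u → ∑ (orbit flip u) (𝟙 ∘ f)) (sym (map-applyUpTo _ (_$ i) n)))
             (∑-orbit-map (_$ i) (λ _ → refl) columns (𝟙 ∘ f)))
    separated-flip : ∀ {col} → Separated col → Separated (flip ∘ col)
    separated-flip {col} sep i d t≤d d+t≤k =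
      trans (leafHit-flip (col i) (col (i + d))) (sep i d t≤d d+t≤k)
    -- As n = t + o, the 2n positions split into two stretches of length t and a middle one of
    -- length 2o, the shape that `katona` expects.
    k≡ : t + ((o + o) + t) ≡ k
    k≡ = trans (lemma t o) (cong (_* 2) t+o≡n)
      where
      lemma : ∀ t o → t + ((o + o) + t) ≡ (t + o) * 2
      lemma = solve-∀
    bound : ∀ {V} → All Separated V → ∑ (upTo k) (λ i → 𝟙 (f (map (_$ i) V))) ≤ t
    bound {V} sep = katona (λ i → f (map (_$ i) V)) t (o + o) apart k (≤-reflexive (sym k≡))
      where
      apart : ∀ i d → t ≤ d → d + t ≤ t + ((o + o) + t) →
        f (map (_$ i) V) ≡ true → f (map (_$ (i + d)) V) ≡ false
      apart i d t≤d d+t≤ fi with f (map (_$ (i + d)) V) in fj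
      ... | false = refl
      ... | true  = trans (sym (cross _ _ fi fj)) (meet-columns i (i + d) V
        (All.map (λ s → s i d t≤d (≤-trans d+t≤ (≤-reflexive k≡))) sep))

leafCount≤weight : ∀ s → leafCount s ≤ weight s
leafCount≤weight none  = z≤n
leafCount≤weight mid   = z≤n
leafCount≤weight left  = ≤-refl
leafCount≤weight right = ≤-refl
leafCount≤weight both  = ≤-refl

leaves≤size : ∀ w → leaves w ≤ size w
leaves≤size []      = z≤n
leaves≤size (s ∷ w) = +-mono-≤ (leafCount≤weight s) (leaves≤size w)

weight-flip : ∀ s → weight (flip s) ≡ weight s
weight-flip none  = refl
weight-flip mid   = refl
weight-flip left  = refl
weight-flip right = refl
weight-flip both  = refl

-- Summing the orbit bound over all words counts each member of the family `orbitSize n` times, and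
-- this factor cancels.
leafMeeting-bound : ∀ n r f .{{_ : NonZero n}} → r ≤ n → CrossMeet leafHit f f →
  (∀ w → f w ≡ true → size w ≡ r) →
  n * 2 * ∑ (words n) (𝟙 ∘ f) ≤ ∑ (words n) (λ w → 𝟙 (does (size w ≟ r)) * leaves w)
leafMeeting-bound n r f r≤n cross supp = *-cancelˡ-≤ (orbitSize n) {{orbitSize≢0 n}} (begin
  orbitSize n * (n * 2 * ∑ (words n) (𝟙 ∘ f))
    ≡⟨ lemma (orbitSize n) (n * 2) (∑ (words n) (𝟙 ∘ f)) ⟩
  n * 2 * (orbitSize n * ∑ (words n) (𝟙 ∘ f))
    ≡⟨ cong (n * 2 *_) (∑-words-orbit n (𝟙 ∘ f)) ⟨
  n * 2 * ∑ (words n) (λ w → ∑ (orbit flip w) (𝟙 ∘ f))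
    ≡⟨ ∑-* (n * 2) (words n) _ ⟨
  ∑ (words n) (λ w → n * 2 * ∑ (orbit flip w) (𝟙 ∘ f))
    ≤⟨ ∑-mono (All.map (λ {w} → pointwise w) (words-length n)) ⟩
  ∑ (words n) (λ w → orbitSize n * (𝟙 (does (size w ≟ r)) * leaves w))
    ≡⟨ ∑-* (orbitSize n) (words n) _ ⟩
  orbitSize n * ∑ (words n) (λ w → 𝟙 (does (size w ≟ r)) * leaves w) ∎)
  where
  open ≤-Reasoning
  lemma : ∀ x y z → x * (y * z) ≡ y * (x * z)
  lemma = solve-∀
  pointwise : ∀ w → length w ≡ n →
    n * 2 * ∑ (orbit flip w) (𝟙 ∘ f) ≤ orbitSize n * (𝟙 (does (size w ≟ r)) * leaves w)
  pointwise w refl with size w ≟ r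
  ... | yes refl = ≤-trans (∑-orbit-bound w f cross (≤-trans (leaves≤size w) r≤n))
    (≤-reflexive (cong (orbitSize n *_) (sym (trans
      (cong (λ b → 𝟙 b * leaves w) (dec-true (size w ≟ size w) refl)) (*-identityˡ (leaves w))))))
  -- Permutations and flips preserve the size, so the orbit of a word of another size avoids the
  -- family.
  ... | no size≢r = ≤-trans (≤-reflexive (trans (cong (n * 2 *_) vanish) (*-zeroʳ (n * 2)))) z≤n
    where
    vanish : ∑ (orbit flip w) (𝟙 ∘ f) ≡ 0
    vanish = trans (∑-congᴬ (All.map (λ {v} → zeroAt v) (orbit-∑ weight weight-flip w))) (∑-0 (orbit flip w))
      where
      zeroAt : ∀ v → size v ≡ size w → 𝟙 (f v) ≡ 0
      zeroAt v eq with f v in fv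
      ... | false = refl
      ... | true  = contradiction (trans (sym eq) (supp v fv)) size≢r

-- Words as independent sets.

-- Three consecutive vertices form a path in the numbering of `pathUnion`, with the centre as the
-- second of them.
encode : ∀ n → Word → Subset (n * 3)
encode zero    _       = []
encode (suc n) []      = false ∷ false ∷ false ∷ encode n []
encode (suc n) (s ∷ w) = hasLeft s ∷ hasMid s ∷ hasRight s ∷ encode n w

-- Only meaningful on traces of independent sets.
trace : Bool → Bool → Bool → Trace
trace true  _     true  = both
trace true  _     false = left
trace false _     true  = right
trace false true  false = mid
trace false false false = none

decode : ∀ n → Subset (n * 3) → Word
decode zero    _               = []
decode (suc n) (l ∷ m ∷ r ∷ A) = trace l m r ∷ decode n A

length-decode : ∀ n A → length (decode n A) ≡ n
length-decode zero    _               = refl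
length-decode (suc n) (l ∷ m ∷ r ∷ A) = cong suc (length-decode n A)

independent-tail : ∀ {n l m r A} → Independent (pathUnion (suc n)) (l ∷ m ∷ r ∷ A) →
  Independent (pathUnion n) A
independent-tail ind u v u∈A v∈A (eq , adj) =
  ind (suc (suc (suc u))) (suc (suc (suc v)))
    (thereᵛ (thereᵛ (thereᵛ u∈A))) (thereᵛ (thereᵛ (thereᵛ v∈A))) (cong suc eq , adj)

encode-decode : ∀ n A → Independent (pathUnion n) A → encode n (decode n A) ≡ A
encode-decode zero    [] ind = refl
encode-decode (suc n) (true ∷ true ∷ r ∷ A) ind =
  ⊥-elim (ind zero (suc zero) hereᵛ (thereᵛ hereᵛ) (refl , e01))
encode-decode (suc n) (l ∷ true ∷ true ∷ A) ind =
  ⊥-elim (ind (suc zero) (suc (suc zero)) (thereᵛ hereᵛ) (thereᵛ (thereᵛ hereᵛ)) (refl , e12))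
encode-decode (suc n) (true ∷ false ∷ true ∷ A) ind =
  cong (λ B → true ∷ false ∷ true ∷ B) (encode-decode n A (independent-tail ind))
encode-decode (suc n) (true ∷ false ∷ false ∷ A) ind =
  cong (λ B → true ∷ false ∷ false ∷ B) (encode-decode n A (independent-tail ind))
encode-decode (suc n) (false ∷ true ∷ false ∷ A) ind =
  cong (λ B → false ∷ true ∷ false ∷ B) (encode-decode n A (independent-tail ind))
encode-decode (suc n) (false ∷ false ∷ true ∷ A) ind =
  cong (λ B → false ∷ false ∷ true ∷ B) (encode-decode n A (independent-tail ind))
encode-decode (suc n) (false ∷ false ∷ false ∷ A) ind =
  cong (λ B → false ∷ false ∷ false ∷ B) (encode-decode n A (independent-tail ind))

encode-independent : ∀ n w → length w ≡ n → Independent (pathUnion n) (encode n w)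
encode-independent (suc n) (both ∷ w) eq (suc zero) v (thereᵛ ()) v∈
encode-independent (suc n) (left ∷ w) eq (suc zero) v (thereᵛ ()) v∈
encode-independent (suc n) (right ∷ w) eq (suc zero) v (thereᵛ ()) v∈
encode-independent (suc n) (none ∷ w) eq (suc zero) v (thereᵛ ()) v∈
encode-independent (suc n) (s ∷ w) eq zero zero u∈ v∈ (_ , ())
encode-independent (suc n) (both ∷ w) eq zero (suc zero) u∈ (thereᵛ ())
encode-independent (suc n) (left ∷ w) eq zero (suc zero) u∈ (thereᵛ ())
encode-independent (suc n) (mid ∷ w) eq zero (suc zero) ()
encode-independent (suc n) (right ∷ w) eq zero (suc zero) ()
encode-independent (suc n) (none ∷ w) eq zero (suc zero) ()
encode-independent (suc n) (s ∷ w) eq zero (suc (suc zero)) u∈ v∈ (_ , ())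
encode-independent (suc n) (s ∷ w) eq zero (suc (suc (suc v))) u∈ v∈ (() , _)
encode-independent (suc n) (mid ∷ w) eq (suc zero) zero u∈ ()
encode-independent (suc n) (mid ∷ w) eq (suc zero) (suc zero) u∈ v∈ (_ , ())
encode-independent (suc n) (mid ∷ w) eq (suc zero) (suc (suc zero)) u∈ (thereᵛ (thereᵛ ()))
encode-independent (suc n) (mid ∷ w) eq (suc zero) (suc (suc (suc v))) u∈ v∈ (() , _)
encode-independent (suc n) (s ∷ w) eq (suc (suc zero)) zero u∈ v∈ (_ , ())
encode-independent (suc n) (both ∷ w) eq (suc (suc zero)) (suc zero) u∈ (thereᵛ ())
encode-independent (suc n) (left ∷ w) eq (suc (suc zero)) (suc zero) u∈ (thereᵛ ())
encode-independent (suc n) (mid ∷ w) eq (suc (suc zero)) (suc zero) (thereᵛ (thereᵛ ()))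
encode-independent (suc n) (right ∷ w) eq (suc (suc zero)) (suc zero) u∈ (thereᵛ ())
encode-independent (suc n) (none ∷ w) eq (suc (suc zero)) (suc zero) u∈ (thereᵛ ())
encode-independent (suc n) (s ∷ w) eq (suc (suc zero)) (suc (suc zero)) u∈ v∈ (_ , ())
encode-independent (suc n) (s ∷ w) eq (suc (suc zero)) (suc (suc (suc v))) u∈ v∈ (() , _)
encode-independent (suc n) (s ∷ w) eq (suc (suc (suc u))) zero u∈ v∈ (() , _)
encode-independent (suc n) (s ∷ w) eq (suc (suc (suc u))) (suc zero) u∈ v∈ (() , _)
encode-independent (suc n) (s ∷ w) eq (suc (suc (suc u))) (suc (suc zero)) u∈ v∈ (() , _)
encode-independent (suc n) (s ∷ w) eq (suc (suc (suc u))) (suc (suc (suc v)))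
  (thereᵛ (thereᵛ (thereᵛ u∈))) (thereᵛ (thereᵛ (thereᵛ v∈))) (eq′ , adj) =
  encode-independent n w (suc-injective eq) u v u∈ v∈ (Fin.suc-injective eq′ , adj)

∣encode∣ : ∀ n w → length w ≡ n → ∣ encode n w ∣ ≡ size w
∣encode∣ zero    []          eq = refl
∣encode∣ (suc n) (none ∷ w)  eq = ∣encode∣ n w (suc-injective eq)
∣encode∣ (suc n) (mid ∷ w)   eq = cong suc (∣encode∣ n w (suc-injective eq))
∣encode∣ (suc n) (left ∷ w)  eq = cong suc (∣encode∣ n w (suc-injective eq))
∣encode∣ (suc n) (right ∷ w) eq = cong suc (∣encode∣ n w (suc-injective eq))
∣encode∣ (suc n) (both ∷ w)  eq = cong (2 +_) (∣encode∣ n w (suc-injective eq))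

meet-encode : ∀ n v w → length v ≡ n → length w ≡ n →
  ∀ u → u ∈ˢ encode n v → u ∈ˢ encode n w → meet hit v w ≡ true
meet-encode (suc n) (s ∷ v) (s′ ∷ w) eq eq′ zero u∈v u∈w =
  head (hasLeft s) (hasLeft s′) ([]=⇒lookup u∈v) ([]=⇒lookup u∈w)
  where
  head : ∀ x y {b c d} → x ≡ true → y ≡ true → ((((x ∧ y) ∨ b) ∨ c) ∨ d) ≡ true
  head _ _ refl refl = refl
meet-encode (suc n) (s ∷ v) (s′ ∷ w) eq eq′ (suc zero) (thereᵛ u∈v) (thereᵛ u∈w) =
  head (leafHit s s′) (hasMid s) (hasMid s′) ([]=⇒lookup u∈v) ([]=⇒lookup u∈w)
  where
  head : ∀ b x y {d} → x ≡ true → y ≡ true → ((b ∨ (x ∧ y)) ∨ d) ≡ true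
  head b _ _ refl refl rewrite ∨-zeroʳ b = refl
meet-encode (suc n) (s ∷ v) (s′ ∷ w) eq eq′ (suc (suc zero))
  (thereᵛ (thereᵛ u∈v)) (thereᵛ (thereᵛ u∈w)) =
  head (hasLeft s ∧ hasLeft s′) (hasRight s) (hasRight s′) ([]=⇒lookup u∈v) ([]=⇒lookup u∈w)
  where
  head : ∀ b x y {c d} → x ≡ true → y ≡ true → (((b ∨ (x ∧ y)) ∨ c) ∨ d) ≡ true
  head b _ _ refl refl rewrite ∨-zeroʳ b = refl
meet-encode (suc n) (s ∷ v) (s′ ∷ w) eq eq′ (suc (suc (suc u)))
  (thereᵛ (thereᵛ (thereᵛ u∈v))) (thereᵛ (thereᵛ (thereᵛ u∈w))) =
  ∨-introʳ (hit s s′) (meet-encode n v w (suc-injective eq) (suc-injective eq′) u u∈v u∈w)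

-- Counting subsets and stars.

length-filter-map : ∀ {P : B → Set} (P? : Decidable P) (h : A → B) xs →
  length (filter P? (map h xs)) ≡ length (filter (λ x → P? (h x)) xs)
length-filter-map P? h []       = refl
length-filter-map P? h (x ∷ xs) with does (P? (h x))
... | true  = cong suc (length-filter-map P? h xs)
... | false = length-filter-map P? h xs

count : ∀ m {P : Subset m → Set} → Decidable P → ℕ
count m P? = length (filter P? (allSubsets m))

count-suc : ∀ m {P : Subset (suc m) → Set} (P? : Decidable P) →
  count (suc m) P? ≡ count m (λ A → P? (true ∷ A)) + count m (λ A → P? (false ∷ A))
count-suc m P? = begin
  count (suc m) P?
    ≡⟨ cong length (filter-++ P? (map (true ∷_) (allSubsets m)) _) ⟩
  length (filter P? (map (true ∷_) (allSubsets m)) ++ filter P? (map (false ∷_) (allSubsets m)))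
    ≡⟨ length-++ (filter P? (map (true ∷_) (allSubsets m))) ⟩
  length (filter P? (map (true ∷_) (allSubsets m))) + length (filter P? (map (false ∷_) (allSubsets m)))
    ≡⟨ cong₂ _+_ (length-filter-map P? (true ∷_) (allSubsets m))
                 (length-filter-map P? (false ∷_) (allSubsets m)) ⟩
  count m (λ A → P? (true ∷ A)) + count m (λ A → P? (false ∷ A)) ∎
  where open ≡-Reasoning

∑-encode-≤-count : ∀ n {P : Subset (n * 3) → Set} (P? : Decidable P) →
  ∑ (words n) (λ w → 𝟙 (does (P? (encode n w)))) ≤ count (n * 3) P?
∑-encode-≤-count zero    P? = ≤-trans (≤-reflexive (∑-words-zero _)) single
  where
  single : 𝟙 (does (P? [])) + 0 ≤ length (filter P? ([] ∷ []))
  single with does (P? [])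
  ... | true  = ≤-refl
  ... | false = z≤n
∑-encode-≤-count (suc n) P? = begin
  ∑ (words (suc n)) (λ w → 𝟙 (does (P? (encode (suc n) w))))
    ≡⟨ trans (∑-words-suc n _) (∑-traces _) ⟩
  ∑ (words n) (λ w → 𝟙 (does (P? (true ∷ false ∷ true ∷ encode n w)))) +
  (∑ (words n) (λ w → 𝟙 (does (P? (true ∷ false ∷ false ∷ encode n w)))) +
  (∑ (words n) (λ w → 𝟙 (does (P? (false ∷ true ∷ false ∷ encode n w)))) +
  (∑ (words n) (λ w → 𝟙 (does (P? (false ∷ false ∷ true ∷ encode n w)))) +
  (∑ (words n) (λ w → 𝟙 (does (P? (false ∷ false ∷ false ∷ encode n w)))) + 0))))
    ≤⟨ +-mono-≤ (ih true false true) (+-mono-≤ (ih true false false) (+-mono-≤ (ih false true false)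
        (+-mono-≤ (ih false false true) (+-mono-≤ (ih false false false) z≤n)))) ⟩
  c true false true + (c true false false + (c false true false + (c false false true + (c false false false + 0))))
    -- The three counts added here belong to the patterns that contain an edge of the path, which no
    -- letter encodes.
    ≤⟨ m≤m+n _ (c true true true + c true true false + c false true true) ⟩
  c true false true + (c true false false + (c false true false + (c false false true + (c false false false + 0))))
    + (c true true true + c true true false + c false true true)
    ≡⟨ lemma (c true true true) (c true true false) (c true false true) (c true false false)
             (c false true true) (c false true false) (c false false true) (c false false false) ⟩
  ((c true true true + c true true false) + (c true false true + c true false false)) +
  ((c false true true + c false true false) + (c false false true + c false false false))
    ≡⟨ cong₂ _+_ (split₂ true) (split₂ false) ⟨
  count (2 + n * 3) (λ A → P? (true ∷ A)) + count (2 + n * 3) (λ A → P? (false ∷ A))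
    ≡⟨ count-suc (2 + n * 3) P? ⟨
  count (suc n * 3) P? ∎
  where
  open ≤-Reasoning
  c : Bool → Bool → Bool → ℕ
  c x y z = count (n * 3) (λ A → P? (x ∷ y ∷ z ∷ A))
  ih : ∀ x y z → ∑ (words n) (λ w → 𝟙 (does (P? (x ∷ y ∷ z ∷ encode n w)))) ≤ c x y z
  ih x y z = ∑-encode-≤-count n (λ A → P? (x ∷ y ∷ z ∷ A))
  split₂ : ∀ x → count (2 + n * 3) (λ A → P? (x ∷ A)) ≡
    (c x true true + c x true false) + (c x false true + c x false false)
  split₂ x = trans (count-suc (1 + n * 3) (λ A → P? (x ∷ A)))
    (cong₂ _+_ (count-suc (n * 3) (λ A → P? (x ∷ true ∷ A))) (count-suc (n * 3) (λ A → P? (x ∷ false ∷ A))))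
  lemma : ∀ a b c d e f g h → c + (d + (f + (g + (h + 0)))) + (a + b + e) ≡
    ((a + b) + (c + d)) + ((e + f) + (g + h))
  lemma = solve-∀

leafVertices : ∀ n → List (Fin (n * 3))
leafVertices zero    = []
leafVertices (suc n) = zero ∷ suc (suc zero) ∷ map (λ v → suc (suc (suc v))) (leafVertices n)

length-leafVertices : ∀ n → length (leafVertices n) ≡ n * 2
length-leafVertices zero    = refl
length-leafVertices (suc n) =
  cong (2 +_) (trans (length-map _ (leafVertices n)) (length-leafVertices n))

leafCount-𝟙 : ∀ s x → leafCount s + x ≡ 𝟙 (hasLeft s) + (𝟙 (hasRight s) + x)
leafCount-𝟙 none  x = refl
leafCount-𝟙 mid   x = refl
leafCount-𝟙 left  x = refl
leafCount-𝟙 right x = refl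
leafCount-𝟙 both  x = refl

leaves-encode : ∀ n w → length w ≡ n →
  leaves w ≡ ∑ (leafVertices n) (λ v → 𝟙 (lookup (encode n w) v))
leaves-encode zero    []      eq = refl
leaves-encode (suc n) (s ∷ w) eq = trans
  (cong (leafCount s +_) (trans (leaves-encode n w (suc-injective eq))
    (sym (∑-map (λ v → suc (suc (suc v))) (leafVertices n) (λ v → 𝟙 (lookup (encode (suc n) (s ∷ w)) v))))))
  (leafCount-𝟙 s _)

starSize≤maxStarSize : ∀ {m} (G : Graph m) r v → starSize G r v ≤ maxStarSize G r
starSize≤maxStarSize G r v = go (allFin _) (∈-allFin v)
  where
  go : ∀ vs → v ∈ vs → starSize G r v ≤ foldr _⊔_ 0 (map (starSize G r) vs)
  go (u ∷ vs) (here refl) = m≤m⊔n (starSize G r u) _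
  go (u ∷ vs) (there v∈)  = ≤-trans (go vs v∈) (m≤n⊔m (starSize G r u) _)

-- Incidences of independent r-sets with leaves, counted by leaf: each of the 2n leaf stars is at
-- most the largest star.
∑-leaves-≤-stars : ∀ n r →
  ∑ (words n) (λ w → 𝟙 (does (size w ≟ r)) * leaves w) ≤ n * 2 * maxStarSize (pathUnion n) r
∑-leaves-≤-stars n r = begin
  ∑ (words n) (λ w → 𝟙 (does (size w ≟ r)) * leaves w)
    ≤⟨ ∑-mono (All.map (λ {w} → pointwise w) (words-length n)) ⟩
  ∑ (words n) (λ w → ∑ (leafVertices n) (λ v → 𝟙 (does (inStar? v (encode n w)))))
    ≡⟨ ∑-swap (words n) (leafVertices n) _ ⟩
  ∑ (leafVertices n) (λ v → ∑ (words n) (λ w → 𝟙 (does (inStar? v (encode n w)))))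
    ≤⟨ ∑-bound (All.universal (λ v → ≤-trans (∑-encode-≤-count n (inStar? v))
         (starSize≤maxStarSize (pathUnion n) r v)) (leafVertices n)) ⟩
  length (leafVertices n) * maxStarSize (pathUnion n) r
    ≡⟨ cong (_* maxStarSize (pathUnion n) r) (length-leafVertices n) ⟩
  n * 2 * maxStarSize (pathUnion n) r ∎
  where
  open ≤-Reasoning
  inStar? : ∀ v → Decidable (λ A → InI (pathUnion n) r A × v ∈ˢ A)
  inStar? v A = inI? (pathUnion n) r A ×-dec (v ∈? A)
  pointwise : ∀ w → length w ≡ n → 𝟙 (does (size w ≟ r)) * leaves w ≤
    ∑ (leafVertices n) (λ v → 𝟙 (does (inStar? v (encode n w))))
  pointwise w len with size w ≟ r
  ... | no size≢r = ≤-trans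
    (≤-reflexive (cong (λ b → 𝟙 b * leaves w) (dec-false (size w ≟ r) size≢r))) z≤n
  ... | yes size≡r = begin
    𝟙 (does (size w ≟ r)) * leaves w
      ≡⟨ cong (λ b → 𝟙 b * leaves w) (dec-true (size w ≟ r) size≡r) ⟩
    1 * leaves w
      ≡⟨ trans (*-identityˡ (leaves w)) (leaves-encode n w len) ⟩
    ∑ (leafVertices n) (λ v → 𝟙 (lookup (encode n w) v))
      ≤⟨ ∑-mono (All.universal member (leafVertices n)) ⟩
    ∑ (leafVertices n) (λ v → 𝟙 (does (inStar? v (encode n w)))) ∎
    where
    member : ∀ v → 𝟙 (lookup (encode n w) v) ≤ 𝟙 (does (inStar? v (encode n w)))
    member v with lookup (encode n w) v in eq
    ... | false = z≤n
    ... | true  = ≤-reflexive (cong 𝟙 (sym (dec-true (inStar? v (encode n w))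
      ((encode-independent n w len , trans (∣encode∣ n w len) size≡r) , lookup⇒[]= v (encode n w) eq))))

-- From a list of sets to a Boolean family of words.

bits : Trace → Bool × Bool × Bool
bits s = hasLeft s , hasMid s , hasRight s

trace-bits : ∀ s → (let l , m , r = bits s in trace l m r) ≡ s
trace-bits none  = refl
trace-bits mid   = refl
trace-bits left  = refl
trace-bits right = refl
trace-bits both  = refl

_≟ᵗ_ : (s s′ : Trace) → Dec (s ≡ s′)
s ≟ᵗ s′ = map′ injective (cong bits) (Product.≡-dec _≟ᵇ_ (Product.≡-dec _≟ᵇ_ _≟ᵇ_) (bits s) (bits s′))
  where
  injective : bits s ≡ bits s′ → s ≡ s′
  injective eq = trans (sym (trace-bits s)) (trans (cong (λ (l , m , r) → trace l m r) eq) (trace-bits s′))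

_≟ʷ_ : (v w : Word) → Dec (v ≡ w)
_≟ʷ_ = List.≡-dec _≟ᵗ_

open import Data.List.Membership.DecPropositional _≟ʷ_ using () renaming (_∈?_ to _∈ʷ?_)

≤-∑-traces : ∀ g s → g s ≤ ∑ traces g
≤-∑-traces g s = subst (g s ≤_) (sym (∑-traces g)) (summand s)
  where
  summand : ∀ s → g s ≤ g both + (g left + (g mid + (g right + (g none + 0))))
  summand both  = m≤m+n _ _
  summand left  = m≤n⇒m≤o+n (g both) (m≤m+n _ _)
  summand mid   = m≤n⇒m≤o+n (g both) (m≤n⇒m≤o+n (g left) (m≤m+n _ _))
  summand right = m≤n⇒m≤o+n (g both) (m≤n⇒m≤o+n (g left) (m≤n⇒m≤o+n (g mid) (m≤m+n _ _)))
  summand none  = m≤n⇒m≤o+n (g both) (m≤n⇒m≤o+n (g left) (m≤n⇒m≤o+n (g mid)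
    (m≤n⇒m≤o+n (g right) (m≤m+n _ _))))

≤-∑-words : ∀ n f w → length w ≡ n → f w ≤ ∑ (words n) f
≤-∑-words zero    f []      eq = subst (f [] ≤_) (sym (∑-words-zero f)) (m≤m+n _ _)
≤-∑-words (suc n) f (s ∷ w) eq = begin
  f (s ∷ w)                              ≤⟨ ≤-∑-words n (f ∘ (s ∷_)) w (suc-injective eq) ⟩
  ∑ (words n) (f ∘ (s ∷_))               ≤⟨ ≤-∑-traces (λ s → ∑ (words n) (f ∘ (s ∷_))) s ⟩
  ∑ traces (λ s → ∑ (words n) (f ∘ (s ∷_))) ≡⟨ ∑-words-suc n f ⟨
  ∑ (words (suc n)) f                    ∎
  where open ≤-Reasoning

length≤∑-words : ∀ n L → Unique L → All (λ w → length w ≡ n) L →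
  length L ≤ ∑ (words n) (λ w → 𝟙 (does (w ∈ʷ? L)))
length≤∑-words n []      _           _            = z≤n
length≤∑-words n (x ∷ L) (x∉L ∷ unq) (len ∷ lens) = begin
  suc (length L)
    ≤⟨ +-mono-≤ once (length≤∑-words n L unq lens) ⟩
  ∑ (words n) (λ w → 𝟙 (does (w ≟ʷ x))) + ∑ (words n) (λ w → 𝟙 (does (w ∈ʷ? L)))
    ≡⟨ ∑-+ (words n) _ _ ⟨
  ∑ (words n) (λ w → 𝟙 (does (w ≟ʷ x)) + 𝟙 (does (w ∈ʷ? L)))
    ≤⟨ ∑-mono (All.universal disjoint (words n)) ⟩
  ∑ (words n) (λ w → 𝟙 (does (w ∈ʷ? (x ∷ L)))) ∎
  where
  open ≤-Reasoning
  once : 1 ≤ ∑ (words n) (λ w → 𝟙 (does (w ≟ʷ x)))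
  once = ≤-trans (≤-reflexive (cong 𝟙 (sym (dec-true (x ≟ʷ x) refl))))
    (≤-∑-words n (λ w → 𝟙 (does (w ≟ʷ x))) x len)
  disjoint : ∀ w → 𝟙 (does (w ≟ʷ x)) + 𝟙 (does (w ∈ʷ? L)) ≤ 𝟙 (does (w ∈ʷ? (x ∷ L)))
  disjoint w = go (w ≟ʷ x)
    where
    go : (d : Dec (w ≡ x)) → 𝟙 (does d) + 𝟙 (does (w ∈ʷ? L)) ≤ 𝟙 (does d ∨ does (w ∈ʷ? L))
    -- Uniqueness keeps `x` out of `L`, so the two indicators never overlap.
    go (yes refl) = ≤-reflexive (cong (λ b → suc (𝟙 b)) (dec-false (w ∈ʷ? L) (All¬⇒¬Any x∉L)))
    go (no _)     = ≤-refl

-- Since `trace` drops a centre next to a leaf, `decode` is injective only on independent sets,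
-- where `encode` inverts it.
unique-decode : ∀ n {F} → All (Independent (pathUnion n)) F → Unique F → Unique (map (decode n) F)
unique-decode n []           []           = []
unique-decode n (ind ∷ inds) (A∉F ∷ unq) = All-map (decode n)
  (λ {B} (indB , A≢B) eq → A≢B (trans (sym (encode-decode n _ ind))
    (trans (cong (encode n) eq) (encode-decode n B indB))))
  (All.zip (inds , A∉F)) ∷ unique-decode n inds unq

theorem1 : (n r : ℕ) → 1 ≤ n → 1 ≤ r → 2 * r ≤ n → IsEKR (pathUnion n) r
theorem1 n@(suc _) r _ _ 2r≤n F (unq , inI , meets) = *-cancelˡ-≤ (n * 2) (begin
  n * 2 * length F
    ≡⟨ cong (n * 2 *_) (length-map (decode n) F) ⟨
  n * 2 * length L
    ≤⟨ *-monoʳ-≤ (n * 2) (length≤∑-words n L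
         (unique-decode n (All.tabulate (λ A∈F → proj₁ (inI A∈F))) unq)
         (All-map {Q = λ _ → ℕ} (decode n) (λ {A} _ → length-decode n A) (All.universal (λ _ → 0) F))) ⟩
  n * 2 * ∑ (words n) (𝟙 ∘ f)
    ≡⟨ cong (n * 2 *_) (∑-compress n f) ⟨
  n * 2 * ∑ (words n) (𝟙 ∘ compress f)
    -- Here the bound on r enters: a word of size r has at most n leaves, so two stretches of that
    -- length fit on the circle of 2n positions.
    ≤⟨ leafMeeting-bound n r (compress f) (≤-trans (m≤m+n r _) 2r≤n)
         (compress-crossMeet f f f-meets) compress-size ⟩
  ∑ (words n) (λ w → 𝟙 (does (size w ≟ r)) * leaves w)
    ≤⟨ ∑-leaves-≤-stars n r ⟩
  n * 2 * maxStarSize (pathUnion n) r ∎)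
  where
  open ≤-Reasoning
  L : List Word
  L = map (decode n) F
  f : Word → Bool
  f w = does (w ∈ʷ? L)
  source : ∀ w → f w ≡ true → ∃[ A ] A ∈ F × w ≡ decode n A
  source w fw with w ∈ʷ? L
  ... | yes w∈L = ∈-map⁻ (decode n) w∈L
  ... | no _    = contradiction fw λ ()
  f-size : ∀ w → f w ≡ true → size w ≡ r
  f-size w fw with source w fw
  ... | A , A∈F , refl = trans (sym (∣encode∣ n (decode n A) (length-decode n A)))
    (trans (cong ∣_∣ (encode-decode n A (proj₁ (inI A∈F)))) (proj₂ (inI A∈F)))
  f-meets : CrossMeet hit f f
  f-meets v w fv fw with source v fv | source w fw
  ... | A , A∈F , refl | B , B∈F , refl with meets A∈F B∈F
  ... | u , u∈A∩B with x∈p∩q⁻ A B u∈A∩B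
  ... | u∈A , u∈B = meet-encode n (decode n A) (decode n B) (length-decode n A) (length-decode n B) u
    (subst (u ∈ˢ_) (sym (encode-decode n A (proj₁ (inI A∈F)))) u∈A)
    (subst (u ∈ˢ_) (sym (encode-decode n B (proj₁ (inI B∈F)))) u∈B)
  compress-size : ∀ w → compress f w ≡ true → size w ≡ r
  compress-size w cw with compress-source f w cw
  ... | v , fv , size≡ , _ = trans (sym size≡) (f-size v fv)
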